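{- There exists an absolute constant $\delta_0>0$ such that the following holds for every $\epsilon\in(0,10^{ -8})$ and every sufficiently large $n$. If $\mathcal{H}$ is a $\mathcal{D}$-free $3$-graph on $n$ vertices with $|\partial\mathcal{H}|=(1/3+\epsilon)n^2$, then $|\mathcal{H}|\le(1/27-\delta_0)n^3$.
   Context: A $3$-graph is a finite vertex set with a set of $3$-element subsets (edges). The shadow is $\partial\mathcal{H}=\{A\in\binom{V(\mathcal{H})}{2}: A\subset B\text{ for some }B\in\mathcal{H}\}$. $\mathcal{K}_4^3$ is the collection of all $3$-graphs $F$ with at most $6$ edges such that for some $4$-set $S$ every pair of vertices of $S$ is contained in some edge of $F$. For $n\ge4$ and a fixed $u\in[n]$, $\mathcal{S}_n$ is the $3$-graph on $[n]$ whose edges are all triples $\{u,v,w\}$ with $\{v,w\}\subset[n]\setminus\{u\}$. $\mathcal{D}$ is the collection of all $F\in\mathcal{K}_4^3$ such that $F$ is not a subgraph of $\mathcal{S}_n$ for any $n\ge4$. $\mathcal{H}$ is $\mathcal{D}$-free if it contains no member of $\mathcal{D}$ as a (not necessarily induced) subgraph. -}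

module Defs where

open import Data.Nat using (ℕ; _≤_; _<ᵇ_)
open import Data.Fin using (Fin; toℕ)
open import Data.Fin.Properties using (_≟_)
open import Data.Bool using (Bool; true; false; if_then_else_; _∧_; _∨_)
open import Data.List using (List; map; foldr; allFin)
open import Data.Nat.ListAction using (sum)
open import Data.Product using (Σ; _×_; ∃)
open import Function.Definitions using (Injective)
open import Relation.Binary.PropositionalEquality using (_≡_)
open import Relation.Nullary using (¬_)
open import Relation.Nullary.Decidable using (⌊_⌋)

-- A 3-graph on vertex set Fin n.  The edge {a,b,c} (a<b<c) is present iff
-- H a b c ≡ true; values of H on non-strictly-increasing triples are ignored.
Graph3 : ℕ → Set
Graph3 n = Fin n → Fin n → Fin n → Bool

_<F_ : ∀ {n} → Fin n → Fin n → Bool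
x <F y = toℕ x <ᵇ toℕ y

edge : ∀ {n} → Graph3 n → Fin n → Fin n → Fin n → Bool
edge H x y z =
  if x <F y ∧ y <F z then H x y z else
  if x <F z ∧ z <F y then H x z y else
  if y <F x ∧ x <F z then H y x z else
  if y <F z ∧ z <F x then H y z x else
  if z <F x ∧ x <F y then H z x y else
  if z <F y ∧ y <F x then H z y x else false

sumFin : ∀ n → (Fin n → ℕ) → ℕ
sumFin n f = sum (map f (allFin n))

anyFin : ∀ n → (Fin n → Bool) → Bool
anyFin n p = foldr (λ i b → p i ∨ b) false (allFin n)

ind : Bool → ℕ
ind true = 1
ind false = 0

size : ∀ {n} → Graph3 n → ℕ
size {n} H = sumFin n λ a → sumFin n λ b → sumFin n λ c →
  ind (a <F b ∧ b <F c ∧ H a b c)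

shadowSize : ∀ {n} → Graph3 n → ℕ
shadowSize {n} H = sumFin n λ a → sumFin n λ b →
  ind (a <F b ∧ anyFin n (λ c → edge H a b c))

Embeds : ∀ {m n} → Graph3 m → Graph3 n → Set
Embeds {m} {n} F H = Σ (Fin m → Fin n) λ f → Injective _≡_ _≡_ f ×
  (∀ a b c → edge F a b c ≡ true → edge H (f a) (f b) (f c) ≡ true)

Star : ∀ n → Fin n → Graph3 n
Star n u a b c = ⌊ a ≟ u ⌋ ∨ ⌊ b ≟ u ⌋ ∨ ⌊ c ≟ u ⌋

InK43 : ∀ {m} → Graph3 m → Set
InK43 {m} F = size F ≤ 6 × Σ (Fin 4 → Fin m) λ s → Injective _≡_ _≡_ s ×
  (∀ i j → ¬ i ≡ j → ∃ λ c → edge F (s i) (s j) c ≡ true)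

SubStar : ∀ {m} → Graph3 m → Set
SubStar F = Σ ℕ λ k → 4 ≤ k × Σ (Fin k) λ u → Embeds F (Star k u)

InD : ∀ {m} → Graph3 m → Set
InD F = InK43 F × ¬ SubStar F

DFree : ∀ {n} → Graph3 n → Set
DFree H = ∀ m (F : Graph3 m) → InD F → ¬ Embeds F H

{-# OPTIONS --safe #-}

-- Call a pair of the shadow heavy if it lies in at least two edges.  D-freeness says that any six edges
-- covering the pairs of a 4-set have a common vertex.  Hence, for a K₄ {x,y,a,b} of the shadow with ab
-- heavy, every edge through x and y has its third vertex in {a,b}, and no K₄ of the shadow contains a
-- heavy triangle.
--
-- Take a maximal family of k disjoint heavy triangles and let m be the number of remaining vertices, so
-- that n = 3k + m.  Every vertex is joined in the shadow to at most two vertices of each triangle.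
-- If 2m ≤ k, adjacent remaining vertices miss the same vertex of at most one triangle, so averaged over
-- the triangles the remaining vertices look 3-partite; this makes the shadow at most n²/3 + n/2, too
-- small for large n.  If 2m > k, all but O(n²) edges are heavy triangles, of which there are at most
-- k³ + k²m + km²/4 by Mantel's theorem on the remaining vertices, at least m³/27 below n³/27.
module Submission where

open import Defs

-- The star `S_n` is itself D-free and has a complete shadow, so K₄s of the shadow cannot be
-- forbidden and Turán's theorem does not apply to the shadow directly. In the star only the pairs
-- through the centre are heavy, so it has no heavy triangle. Heaviness thus filters out such K₄s,
-- at the price of at most one edge for each light pair.
--
-- The threshold between the two cases balances a loss against a gain. A remaining vertex not joined
-- to exactly two vertices of a triangle spoils the 3-partite pattern for at most 2m ordered pairs
-- of remaining vertices, but it also has at least one neighbour fewer in that triangle than the two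
-- allowed. Averaged over the k triangles, the gain repays the loss when 2m ≤ k.
--
-- In the other case k ≤ 2m gives n = 3k + m ≤ 7m, so m³/27 is at least n³/9261. Half of this gap is
-- the constant 1/18522. The other half absorbs the at most n²/2 edges that contain a light pair, as
-- soon as n ≥ 9261.

module Combinatorics where

  open import Data.Nat as ℕ using (ℕ; zero; suc; z≤n; s≤s; _+_; _*_; _≤_; _^_)
  import Data.Nat.Properties as ℕₚ
  open import Data.Nat.ListAction using (sum)
  open import Data.Nat.Tactic.RingSolver using (solve-∀)
  open import Data.Bool using (Bool; true; false; not; _∧_; _∨_; if_then_else_) renaming (T to IsTrue)
  import Data.Bool.Properties as Boolₚ
  open import Data.Fin using (Fin; zero; suc; toℕ; _<_)
  open import Data.Fin.Properties using (_≟_; any?; <-cmp)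
  open import Data.List using (List; []; _∷_; map; foldr; length; allFin)
  open import Data.List.Properties using (length-tabulate)
  open import Data.List.Membership.Propositional using (_∈_; find; lose)
  open import Data.List.Membership.Propositional.Properties using (∈-allFin)
  open import Data.List.Relation.Unary.Any as Any using (here; there)
  open import Data.List.Relation.Unary.All as All using (All; []; _∷_; all?)
  open import Data.List.Relation.Unary.AllPairs using ([]; _∷_)
  open import Data.List.Relation.Unary.Unique.Propositional using (Unique)
  open import Data.List.Relation.Unary.Unique.Propositional.Properties using (allFin⁺)
  open import Data.Vec using (lookup; []; _∷_)
  open import Data.Product using (Σ; ∃; _×_; _,_; proj₁; proj₂)
  open import Data.Sum using (_⊎_; inj₁; inj₂; [_,_]′)
  open import Data.Empty using (⊥; ⊥-elim)
  open import Data.Unit using (tt)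
  open import Relation.Nullary using (¬_; Dec; yes; no)
  open import Relation.Nullary.Decidable using (⌊_⌋; map′; _×-dec_; _⊎-dec_; ¬?; True; toWitness)
  open import Relation.Binary.Definitions using (tri<; tri≈; tri>)
  open import Relation.Binary.PropositionalEquality
  open import Function using (_∘_; id; case_of_)
  open import Function.Bundles using (mk⇔)
  open import Function.Definitions using (Injective)
  open ℕₚ.≤-Reasoning

  -- Edges as unordered triples

  data Perm₃ {A : Set} (a b c : A) : A → A → A → Set where
    perm-abc : Perm₃ a b c a b c
    perm-acb : Perm₃ a b c a c b
    perm-bac : Perm₃ a b c b a c
    perm-bca : Perm₃ a b c b c a
    perm-cab : Perm₃ a b c c a b
    perm-cba : Perm₃ a b c c b a

  Sorted : ∀ {n} → Fin n → Fin n → Fin n → Set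
  Sorted a b c = (a <F b) ≡ true × (b <F c) ≡ true

  -- Exhibits the sorted representative at which `edge` reads `H`. Symmetry of `edge` then only
  -- exchanges constructors of `Perm₃`, instead of comparing the nested conditionals for two
  -- argument orders.
  SortedEdge : ∀ {n} → Graph3 n → Fin n → Fin n → Fin n → Set
  SortedEdge {n} H x y z = Σ (Fin n) λ a → Σ (Fin n) λ b → Σ (Fin n) λ c →
    Sorted a b c × H a b c ≡ true × Perm₃ a b c x y z

  -- Unlike the equation it wraps, which unfolds to nested conditionals, this lets Agda infer the vertices.
  record IsEdge {n} (H : Graph3 n) (x y z : Fin n) : Set where
    constructor mkEdge
    field
      holds : edge H x y z ≡ true

  <F⇒< : ∀ {n} (x y : Fin n) → (x <F y) ≡ true → toℕ x ℕ.< toℕ y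
  <F⇒< x y p = ℕₚ.<ᵇ⇒< (toℕ x) (toℕ y) (subst IsTrue (sym p) tt)

  <F-asym : ∀ {n} (x y : Fin n) → (x <F y) ≡ true → (y <F x) ≡ false
  <F-asym x y p with y <F x in q
  ... | false = refl
  ... | true = ⊥-elim (ℕₚ.<-asym (<F⇒< x y p) (<F⇒< y x q))

  <F-trans : ∀ {n} (x y z : Fin n) → (x <F y) ≡ true → (y <F z) ≡ true → (x <F z) ≡ true
  <F-trans x y z p q with x <F z in r
  ... | true = refl
  ... | false = ⊥-elim (subst IsTrue r (ℕₚ.<⇒<ᵇ (ℕₚ.<-trans (<F⇒< x y p) (<F⇒< y z q))))

  <F⇒≢ : ∀ {n} {x y : Fin n} → (x <F y) ≡ true → x ≢ y
  <F⇒≢ {x = x} p refl = ℕₚ.<-irrefl refl (<F⇒< x x p)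

  ∧-split : ∀ {p q} → p ∧ q ≡ true → p ≡ true × q ≡ true
  ∧-split {true} {true} _ = refl , refl

  if-split : ∀ {b t e} → (if b then t else e) ≡ true → (b ≡ true × t ≡ true) ⊎ e ≡ true
  if-split {true}  p = inj₁ (refl , p)
  if-split {false} p = inj₂ p

  module _ {n} (H : Graph3 n) where

    edge⇒sorted : ∀ {x y z} → IsEdge H x y z → SortedEdge H x y z
    edge⇒sorted {x} {y} {z} (mkEdge e) with if-split {x <F y ∧ y <F z} e
    ... | inj₁ (s , h) = _ , _ , _ , ∧-split s , h , perm-abc
    ... | inj₂ e with if-split {x <F z ∧ z <F y} e
    ... | inj₁ (s , h) = _ , _ , _ , ∧-split s , h , perm-acb
    ... | inj₂ e with if-split {y <F x ∧ x <F z} e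
    ... | inj₁ (s , h) = _ , _ , _ , ∧-split s , h , perm-bac
    ... | inj₂ e with if-split {y <F z ∧ z <F x} e
    -- The sorted triple is (y, z, x) here, so (x, y, z) reads c, a, b: for the two cyclic orders
    -- the constructor names the inverse of the sorting permutation.
    ... | inj₁ (s , h) = _ , _ , _ , ∧-split s , h , perm-cab
    ... | inj₂ e with if-split {z <F x ∧ x <F y} e
    ... | inj₁ (s , h) = _ , _ , _ , ∧-split s , h , perm-bca
    ... | inj₂ e with if-split {z <F y ∧ y <F x} e
    ... | inj₁ (s , h) = _ , _ , _ , ∧-split s , h , perm-cba

    sorted⇒edge : ∀ {x y z} → SortedEdge H x y z → IsEdge H x y z
    sorted⇒edge (a , b , c , (p , q) , h , π) = mkEdge (go π)
      where
      go : ∀ {x y z} → Perm₃ a b c x y z → edge H x y z ≡ true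
      go π with <F-trans a b c p q
      go perm-abc | r rewrite p | q = h
      go perm-acb | r rewrite p | q | r | <F-asym b c q = h
      go perm-bac | r rewrite p | q | r | <F-asym a c r | <F-asym a b p = h
      go perm-bca | r rewrite p | q | r | <F-asym b c q | <F-asym a c r | <F-asym a b p = h
      go perm-cab | r rewrite p | q | r | <F-asym b c q | <F-asym a c r = h
      go perm-cba | r rewrite p | q | r | <F-asym b c q | <F-asym a c r | <F-asym a b p = h

    edge-swap₁₂ : ∀ {x y z} → IsEdge H x y z → IsEdge H y x z
    edge-swap₁₂ e with edge⇒sorted e
    ... | a , b , c , s , h , π = sorted⇒edge (a , b , c , s , h , swap π)
      where
      swap : ∀ {x y z} → Perm₃ a b c x y z → Perm₃ a b c y x z
      swap perm-abc = perm-bac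
      swap perm-acb = perm-cab
      swap perm-bac = perm-abc
      swap perm-bca = perm-cba
      swap perm-cab = perm-acb
      swap perm-cba = perm-bca

    edge-swap₂₃ : ∀ {x y z} → IsEdge H x y z → IsEdge H x z y
    edge-swap₂₃ e with edge⇒sorted e
    ... | a , b , c , s , h , π = sorted⇒edge (a , b , c , s , h , swap π)
      where
      swap : ∀ {x y z} → Perm₃ a b c x y z → Perm₃ a b c x z y
      swap perm-abc = perm-acb
      swap perm-acb = perm-abc
      swap perm-bac = perm-bca
      swap perm-bca = perm-bac
      swap perm-cab = perm-cba
      swap perm-cba = perm-cab

    edge⇒≢ : ∀ {x y z} → IsEdge H x y z → x ≢ y
    edge⇒≢ e with edge⇒sorted e
    ... | a , b , c , (p , q) , h , π = distinct π
      where
      distinct : ∀ {x y z} → Perm₃ a b c x y z → x ≢ y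
      distinct perm-abc = <F⇒≢ p
      distinct perm-acb = <F⇒≢ (<F-trans a b c p q)
      distinct perm-bac = ≢-sym (<F⇒≢ p)
      distinct perm-bca = <F⇒≢ q
      distinct perm-cab = ≢-sym (<F⇒≢ (<F-trans a b c p q))
      distinct perm-cba = ≢-sym (<F⇒≢ q)

  -- Finite sums

  ∑ : {A : Set} → List A → (A → ℕ) → ℕ
  ∑ L f = sum (map f L)

  private
    variable
      A B : Set

  ∑-mono-∈ : (L : List A) {f g : A → ℕ} → (∀ {x} → x ∈ L → f x ≤ g x) → ∑ L f ≤ ∑ L g
  ∑-mono-∈ []      h = z≤n
  ∑-mono-∈ (x ∷ L) h = ℕₚ.+-mono-≤ (h (here refl)) (∑-mono-∈ L (h ∘ there))

  ∑-mono : (L : List A) {f g : A → ℕ} → (∀ x → f x ≤ g x) → ∑ L f ≤ ∑ L g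
  ∑-mono L h = ∑-mono-∈ L (λ {x} _ → h x)

  ∑-cong : (L : List A) {f g : A → ℕ} → (∀ x → f x ≡ g x) → ∑ L f ≡ ∑ L g
  ∑-cong []      h = refl
  ∑-cong (x ∷ L) h = cong₂ _+_ (h x) (∑-cong L h)

  ∑-+ : (L : List A) (f g : A → ℕ) → ∑ L (λ x → f x + g x) ≡ ∑ L f + ∑ L g
  ∑-+ []      f g = refl
  ∑-+ (x ∷ L) f g rewrite ∑-+ L f g = interchange (f x) (g x) (∑ L f) (∑ L g)
    where
    interchange : ∀ a b c d → a + b + (c + d) ≡ a + c + (b + d)
    interchange = solve-∀

  ∑-*ˡ : (L : List A) (c : ℕ) (f : A → ℕ) → ∑ L (λ x → c * f x) ≡ c * ∑ L f
  ∑-*ˡ []      c f = sym (ℕₚ.*-zeroʳ c)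
  ∑-*ˡ (x ∷ L) c f rewrite ∑-*ˡ L c f = sym (ℕₚ.*-distribˡ-+ c (f x) (∑ L f))

  ∑-*ʳ : (L : List A) (f : A → ℕ) (c : ℕ) → ∑ L (λ x → f x * c) ≡ ∑ L f * c
  ∑-*ʳ []      f c = refl
  ∑-*ʳ (x ∷ L) f c rewrite ∑-*ʳ L f c = sym (ℕₚ.*-distribʳ-+ c (f x) (∑ L f))

  ∑-const : (L : List A) (c : ℕ) → ∑ L (λ _ → c) ≡ length L * c
  ∑-const []      c = refl
  ∑-const (x ∷ L) c = cong (c +_) (∑-const L c)

  ∑-swap : (L : List A) (M : List B) (f : A → B → ℕ) →
    ∑ L (λ x → ∑ M (f x)) ≡ ∑ M (λ y → ∑ L (λ x → f x y))
  ∑-swap []      M f = sym (trans (∑-const M 0) (ℕₚ.*-zeroʳ (length M)))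
  ∑-swap (x ∷ L) M f rewrite ∑-swap L M f = sym (∑-+ M (f x) (λ y → ∑ L (λ x → f x y)))

  ∑-≤ : (L : List A) {f : A → ℕ} (c : ℕ) → (∀ {x} → x ∈ L → f x ≤ c) → ∑ L f ≤ length L * c
  ∑-≤ L c h = ℕₚ.≤-trans (∑-mono-∈ L h) (ℕₚ.≤-reflexive (∑-const L c))

  ∑-0 : (L : List A) {f : A → ℕ} → (∀ {x} → x ∈ L → f x ≡ 0) → ∑ L f ≡ 0
  ∑-0 L h = ℕₚ.n≤0⇒n≡0 (ℕₚ.≤-trans (∑-≤ L 0 (ℕₚ.≤-reflexive ∘ h)) (ℕₚ.≤-reflexive (ℕₚ.*-zeroʳ (length L))))

  δ : ∀ {n} → Fin n → Fin n → ℕ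
  δ z v = ind ⌊ v ≟ z ⌋

  δ-≢ : ∀ {n} {z v : Fin n} → v ≢ z → δ z v ≡ 0
  δ-≢ {z = z} {v} v≢z with v ≟ z
  ... | no  _   = refl
  ... | yes v≡z = ⊥-elim (v≢z v≡z)

  δ-≡ : ∀ {n} (z : Fin n) → δ z z ≡ 1
  δ-≡ z with z ≟ z
  ... | yes _   = refl
  ... | no  z≢z = ⊥-elim (z≢z refl)

  ∑-δ : ∀ {n} (L : List (Fin n)) → Unique L → ∀ z → ∑ L (δ z) ≤ 1
  ∑-δ []      _            z = z≤n
  ∑-δ (x ∷ L) (x∉L ∷ uniq) z with x ≟ z
  ... | no  _    = ∑-δ L uniq z
  ... | yes refl = ℕₚ.≤-reflexive (cong suc (∑-0 L λ y∈L → δ-≢ (≢-sym (All.lookup x∉L y∈L))))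

  ∑-allFin-δ : ∀ {n} (z : Fin n) → ∑ (allFin n) (δ z) ≤ 1
  ∑-allFin-δ {n} = ∑-δ (allFin n) (allFin⁺ n)

  -- Inequalities between expressions in Boolean variables are settled by instance search, which
  -- assembles a decision procedure running through all truth values.
  instance
    dec-≤ : ∀ {m n} → Dec (m ≤ n)
    dec-≤ {m} {n} = m ℕ.≤? n

    dec-≡ : {m n : ℕ} → Dec (m ≡ n)
    dec-≡ {m} {n} = m ℕ.≟ n

    dec-∀Bool : {P : Bool → Set} → {{∀ {b} → Dec (P b)}} → Dec (∀ b → P b)
    dec-∀Bool {{P?}} = map′ (λ { (t , f) true → t ; (t , f) false → f })
      (λ h → h true , h false) (P? {true} ×-dec P? {false})

  byCases : {P : Set} → {{P? : Dec P}} → {True P?} → P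
  byCases {{P?}} {t} = toWitness {a? = P?} t

  private
    variable
      n : ℕ

  -- Covering families in D-free 3-graphs

  Triple : ℕ → Set
  Triple n = Fin n × Fin n × Fin n

  -- Positions are compared literally, so a listed triple yields an edge only if it is sorted; this
  -- is why edges pass through `sortEdges` first.
  fromList : List (Triple n) → Graph3 n
  fromList []                 a b c = false
  fromList ((x , y , z) ∷ ts) a b c = (⌊ a ≟ x ⌋ ∧ ⌊ b ≟ y ⌋ ∧ ⌊ c ≟ z ⌋) ∨ fromList ts a b c

  sumFin³ : (Fin n → Fin n → Fin n → ℕ) → ℕ
  sumFin³ {n} f = ∑ (allFin n) λ a → ∑ (allFin n) λ b → ∑ (allFin n) λ c → f a b c

  sumFin³-mono : {f g : Fin n → Fin n → Fin n → ℕ} → (∀ a b c → f a b c ≤ g a b c) → sumFin³ f ≤ sumFin³ g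
  sumFin³-mono {n} h = ∑-mono (allFin n) λ a → ∑-mono (allFin n) λ b → ∑-mono (allFin n) λ c → h a b c

  sumFin³-+ : (f g : Fin n → Fin n → Fin n → ℕ) →
    sumFin³ (λ a b c → f a b c + g a b c) ≡ sumFin³ f + sumFin³ g
  sumFin³-+ {n} f g = trans
    (∑-cong V λ a → trans (∑-cong V λ b → ∑-+ V (f a b) (g a b)) (∑-+ V _ _))
    (∑-+ V _ _)
    where V = allFin n

  sumFin³-δ : (x y z : Fin n) → sumFin³ (λ a b c → δ x a * (δ y b * δ z c)) ≤ 1
  sumFin³-δ {n} x y z = begin
    sumFin³ (λ a b c → δ x a * (δ y b * δ z c))
      ≡⟨ ∑-cong V (λ a → ∑-cong V λ b → trans (∑-*ˡ V (δ x a) _) (cong (δ x a *_) (∑-*ˡ V (δ y b) _))) ⟩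
    ∑ V (λ a → ∑ V (λ b → δ x a * (δ y b * ∑ V (δ z))))
      ≡⟨ ∑-cong V (λ a → trans (∑-*ˡ V (δ x a) _) (cong (δ x a *_) (∑-*ʳ V (δ y) _))) ⟩
    ∑ V (λ a → δ x a * (∑ V (δ y) * ∑ V (δ z)))  ≡⟨ ∑-*ʳ V (δ x) _ ⟩
    ∑ V (δ x) * (∑ V (δ y) * ∑ V (δ z))
      ≤⟨ ℕₚ.*-mono-≤ (∑-allFin-δ x) (ℕₚ.*-mono-≤ (∑-allFin-δ y) (∑-allFin-δ z)) ⟩
    1 ∎
    where
    V = allFin n

  -- Only an upper bound, because repetitions must be allowed: one edge may cover several pairs of
  -- the 4-set and then occurs several times among the six. Each listed triple contributes a point
  -- mass of total at most 1.
  size-fromList : (ts : List (Triple n)) → size (fromList ts) ≤ length ts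
  size-fromList {n} [] = ℕₚ.≤-reflexive (∑-0 V λ {a} _ → ∑-0 V λ {b} _ → ∑-0 V λ {c} _ →
    ℕₚ.n≤0⇒n≡0 (zero-case (a <F b) (b <F c)))
    where
    V = allFin n
    zero-case : ∀ p q → ind (p ∧ q ∧ false) ≤ 0
    zero-case = byCases
  size-fromList {n} ((x , y , z) ∷ ts) = begin
    size (fromList ((x , y , z) ∷ ts))  ≤⟨ sumFin³-mono split ⟩
    sumFin³ (λ a b c → δ x a * (δ y b * δ z c) + ind (a <F b ∧ b <F c ∧ fromList ts a b c))
      ≡⟨ sumFin³-+ _ (λ a b c → ind (a <F b ∧ b <F c ∧ fromList ts a b c)) ⟩
    sumFin³ (λ a b c → δ x a * (δ y b * δ z c)) + size (fromList ts)
      ≤⟨ ℕₚ.+-mono-≤ (sumFin³-δ x y z) (size-fromList ts) ⟩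
    suc (length ts) ∎
    where
    split′ : ∀ p q r s t u → ind (p ∧ q ∧ ((r ∧ s ∧ t) ∨ u)) ≤ ind r * (ind s * ind t) + ind (p ∧ q ∧ u)
    split′ = byCases
    split : ∀ a b c → _
    split a b c = split′ (a <F b) (b <F c) ⌊ a ≟ x ⌋ ⌊ b ≟ y ⌋ ⌊ c ≟ z ⌋ (fromList ts a b c)

  ∨-split : ∀ {p q} → p ∨ q ≡ true → p ≡ true ⊎ q ≡ true
  ∨-split {true}  h = inj₁ refl
  ∨-split {false} h = inj₂ h

  ⌊≟⌋⇒≡ : {x y : Fin n} → ⌊ x ≟ y ⌋ ≡ true → x ≡ y
  ⌊≟⌋⇒≡ {x = x} {y} h with x ≟ y
  ... | yes p = p
  ⌊≟⌋⇒≡ () | no _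

  fromList-sound : (ts : List (Triple n)) {P : Fin n → Fin n → Fin n → Set} →
    All (λ (x , y , z) → P x y z) ts → ∀ {a b c} → fromList ts a b c ≡ true → P a b c
  fromList-sound ((x , y , z) ∷ ts) (p ∷ ps) {a} {b} {c} h with ∨-split h
  ... | inj₂ h = fromList-sound ts ps h
  ... | inj₁ h with ∧-split {⌊ a ≟ x ⌋} h
  ... | ha , hbc with ∧-split {⌊ b ≟ y ⌋} hbc
  ... | hb , hc with ⌊≟⌋⇒≡ {x = a} ha | ⌊≟⌋⇒≡ {x = b} hb | ⌊≟⌋⇒≡ {x = c} hc
  ... | refl | refl | refl = p

  ⌊≟⌋-refl : (x : Fin n) → ⌊ x ≟ x ⌋ ≡ true
  ⌊≟⌋-refl x with x ≟ x
  ... | yes _ = refl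
  ... | no ¬p = ⊥-elim (¬p refl)

  fromList-∷ : (t : Triple n) (ts : List (Triple n)) {a b c : Fin n} →
    fromList ts a b c ≡ true → fromList (t ∷ ts) a b c ≡ true
  fromList-∷ t ts h rewrite h = Boolₚ.∨-zeroʳ _

  fromList-complete : {ts : List (Triple n)} {a b c : Fin n} → (a , b , c) ∈ ts → fromList ts a b c ≡ true
  fromList-complete {a = a} {b} {c} (here refl)
    rewrite ⌊≟⌋-refl a | ⌊≟⌋-refl b | ⌊≟⌋-refl c = refl
  fromList-complete {ts = t ∷ ts} (there t∈ts) = fromList-∷ t ts (fromList-complete t∈ts)

  _∈₃_ : Fin n → Triple n → Set
  p ∈₃ (x , y , z) = p ≡ x ⊎ p ≡ y ⊎ p ≡ z

  ∈₃? : (p : Fin n) (t : Triple n) → Dec (p ∈₃ t)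
  ∈₃? p (x , y , z) = (p ≟ x) ⊎-dec ((p ≟ y) ⊎-dec (p ≟ z))

  ∈₃-perm : ∀ {p a b c x y z : Fin n} → Perm₃ a b c x y z → p ∈₃ (a , b , c) → p ∈₃ (x , y , z)
  ∈₃-perm perm-abc h = h
  ∈₃-perm perm-acb (inj₁ h) = inj₁ h
  ∈₃-perm perm-acb (inj₂ (inj₁ h)) = inj₂ (inj₂ h)
  ∈₃-perm perm-acb (inj₂ (inj₂ h)) = inj₂ (inj₁ h)
  ∈₃-perm perm-bac (inj₁ h) = inj₂ (inj₁ h)
  ∈₃-perm perm-bac (inj₂ (inj₁ h)) = inj₁ h
  ∈₃-perm perm-bac (inj₂ (inj₂ h)) = inj₂ (inj₂ h)
  ∈₃-perm perm-bca (inj₁ h) = inj₂ (inj₂ h)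
  ∈₃-perm perm-bca (inj₂ (inj₁ h)) = inj₁ h
  ∈₃-perm perm-bca (inj₂ (inj₂ h)) = inj₂ (inj₁ h)
  ∈₃-perm perm-cab (inj₁ h) = inj₂ (inj₁ h)
  ∈₃-perm perm-cab (inj₂ (inj₁ h)) = inj₂ (inj₂ h)
  ∈₃-perm perm-cab (inj₂ (inj₂ h)) = inj₁ h
  ∈₃-perm perm-cba (inj₁ h) = inj₂ (inj₂ h)
  ∈₃-perm perm-cba (inj₂ (inj₁ h)) = inj₂ (inj₁ h)
  ∈₃-perm perm-cba (inj₂ (inj₂ h)) = inj₁ h

  star-center : ∀ {k} {u x y z : Fin k} → IsEdge (Star k u) x y z → u ∈₃ (x , y , z)
  star-center {k} {u} e with edge⇒sorted (Star k u) e
  ... | a , b , c , _ , h , π = ∈₃-perm π (center h)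
    where
    center : ⌊ a ≟ u ⌋ ∨ ⌊ b ≟ u ⌋ ∨ ⌊ c ≟ u ⌋ ≡ true → u ∈₃ (a , b , c)
    center h with ∨-split {⌊ a ≟ u ⌋} h
    ... | inj₁ h = inj₁ (sym (⌊≟⌋⇒≡ h))
    ... | inj₂ h with ∨-split {⌊ b ≟ u ⌋} h
    ... | inj₁ h = inj₂ (inj₁ (sym (⌊≟⌋⇒≡ h)))
    ... | inj₂ h = inj₂ (inj₂ (sym (⌊≟⌋⇒≡ h)))

  module _ (H : Graph3 n) where

    Edge : Triple n → Set
    Edge (x , y , z) = IsEdge H x y z

    sortEdges : {es : List (Triple n)} → All Edge es → List (Triple n)
    sortEdges [] = []
    sortEdges (e ∷ es) = let a , b , c , _ = edge⇒sorted H e in (a , b , c) ∷ sortEdges es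

    sortEdges-length : {es : List (Triple n)} (hs : All Edge es) → length (sortEdges hs) ≡ length es
    sortEdges-length [] = refl
    sortEdges-length (e ∷ es) = cong suc (sortEdges-length es)

    sortEdges-⊆ : {es : List (Triple n)} (hs : All Edge es) →
      All (λ (a , b , c) → H a b c ≡ true) (sortEdges hs)
    sortEdges-⊆ [] = []
    sortEdges-⊆ (e ∷ es) = let _ , _ , _ , _ , h , _ = edge⇒sorted H e in h ∷ sortEdges-⊆ es

    sortEdges-edge : {es : List (Triple n)} (hs : All Edge es) {x y z : Fin n} →
      (x , y , z) ∈ es → SortedEdge (fromList (sortEdges hs)) x y z
    sortEdges-edge (e ∷ es) (here refl) =
      let a , b , c , s , h , π = edge⇒sorted H e in
      a , b , c , s , fromList-complete {ts = _ ∷ sortEdges es} (here refl) , π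
    sortEdges-edge (e ∷ es) (there t∈) =
      let a , b , c , s , h , π = sortEdges-edge es t∈ in
      a , b , c , s , fromList-∷ _ (sortEdges es) h , π

    module _ (dfree : DFree H) where

      -- Otherwise the 3-graph formed by `es` would be a member of D inside `H`: `cover` puts it in
      -- K₄³, and an embedding into a star would make the preimage of the centre a common vertex.
      commonVertex : (s : Fin 4 → Fin n) (es : List (Triple n)) → length es ≤ 6 →
        All Edge es → (∀ {i j} → i < j → ∃ λ c → (s i , s j , c) ∈ es) → ∃ λ p → All (p ∈₃_) es
      commonVertex s es len hs cover with any? (λ p → all? (∈₃? p) es)
      ... | yes p = p
      ... | no ¬p = ⊥-elim (dfree n F (inK43 , notStar)
          (id , id , λ a b c e → IsEdge.holds (sorted⇒edge H (inH (mkEdge {x = a} {b} {c} e)))))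
        where
        F : Graph3 n
        F = fromList (sortEdges hs)

        edgeF : ∀ {x y z} → (x , y , z) ∈ es → IsEdge F x y z
        edgeF t∈ = sorted⇒edge F (sortEdges-edge hs t∈)

        inH : ∀ {x y z} → IsEdge F x y z → SortedEdge H x y z
        inH e with edge⇒sorted F e
        ... | a , b , c , srt , h , π = a , b , c , srt , fromList-sound (sortEdges hs) (sortEdges-⊆ hs) h , π

        -- The values of `s` are distinct because `cover` places any two of them in a common edge.
        inj : Injective _≡_ _≡_ s
        inj {i} {j} q with <-cmp i j
        ... | tri< i<j _ _ = ⊥-elim (edge⇒≢ H (All.lookup hs (proj₂ (cover i<j))) q)
        ... | tri≈ _ i≡j _ = i≡j
        ... | tri> _ _ j<i = ⊥-elim (edge⇒≢ H (All.lookup hs (proj₂ (cover j<i))) (sym q))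

        covered : ∀ i j → i ≢ j → ∃ λ c → edge F (s i) (s j) c ≡ true
        covered i j i≢j with <-cmp i j
        ... | tri< i<j _ _ = let c , c∈ = cover i<j in c , IsEdge.holds (edgeF c∈)
        ... | tri≈ _ i≡j _ = ⊥-elim (i≢j i≡j)
        ... | tri> _ _ j<i = let c , c∈ = cover j<i in c , IsEdge.holds (edge-swap₁₂ F (edgeF c∈))

        inK43 : InK43 F
        inK43 = ℕₚ.≤-trans (size-fromList (sortEdges hs)) (subst (_≤ 6) (sym (sortEdges-length hs)) len)
              , s , inj , covered

        notStar : ¬ SubStar F
        -- One edge suffices to show that the centre `u` is a value of `f`; by injectivity its
        -- preimage then lies in every edge of `es`.
        notStar (k , _ , u , f , finj , femb) = case cover {zero} {suc zero} (s≤s z≤n) of λ (c , c∈) →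
            ¬p (case center c∈ of λ
              { (inj₁ q)        → _ , preimage q
              ; (inj₂ (inj₁ q)) → _ , preimage q
              ; (inj₂ (inj₂ q)) → _ , preimage q })
          where
          center : ∀ {x y z} → (x , y , z) ∈ es → u ∈₃ (f x , f y , f z)
          center t∈ = star-center (mkEdge {x = f _} {f _} {f _} (femb _ _ _ (IsEdge.holds (edgeF t∈))))

          preimage : ∀ {p} → u ≡ f p → All (p ∈₃_) es
          preimage q = All.tabulate λ t∈ → case center t∈ of λ
            { (inj₁ r)        → inj₁ (finj (trans (sym q) r))
            ; (inj₂ (inj₁ r)) → inj₂ (inj₁ (finj (trans (sym q) r)))
            ; (inj₂ (inj₂ r)) → inj₂ (inj₂ (finj (trans (sym q) r))) }

  anyFin-sound : ∀ {n} {p : Fin n → Bool} → anyFin n p ≡ true → ∃ λ i → p i ≡ true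
  anyFin-sound {n} {p} = go (allFin n)
    where
    go : (L : List (Fin n)) → foldr (λ i b → p i ∨ b) false L ≡ true → ∃ λ i → p i ≡ true
    go (i ∷ L) h = [ (λ q → i , q) , go L ]′ (∨-split h)

  anyFin-complete : ∀ {n} {p : Fin n → Bool} {i} → p i ≡ true → anyFin n p ≡ true
  anyFin-complete {n} {p} {i} q = go (∈-allFin i)
    where
    go : {L : List (Fin n)} → i ∈ L → foldr (λ i b → p i ∨ b) false L ≡ true
    go (here refl) rewrite q = refl
    go {j ∷ L} (there i∈L) rewrite go i∈L = Boolₚ.∨-zeroʳ (p j)

  -- Heavy pairs inside a K₄ of the shadow

  module _ {n} (H : Graph3 n) where

    private
      E₃ : Fin n → Fin n → Fin n → Set
      E₃ = IsEdge H

      p132 : ∀ {x y z} → E₃ x y z → E₃ x z y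
      p132 = edge-swap₂₃ H
      p213 : ∀ {x y z} → E₃ x y z → E₃ y x z
      p213 = edge-swap₁₂ H
      p312 : ∀ {x y z} → E₃ x y z → E₃ z x y
      p312 e = p213 (p132 e)
      p231 : ∀ {x y z} → E₃ x y z → E₃ y z x
      p231 e = p132 (p213 e)
      p321 : ∀ {x y z} → E₃ x y z → E₃ z y x
      p321 e = p213 (p231 e)

      absurd : ∀ {p x y z : Fin n} → p ∈₃ (x , y , z) → p ≢ x → p ≢ y → p ≢ z → ⊥
      absurd (inj₁ q)        p≢x _ _ = p≢x q
      absurd (inj₂ (inj₁ q)) _ p≢y _ = p≢y q
      absurd (inj₂ (inj₂ q)) _ _ p≢z = p≢z q

      third : ∀ {p x y z : Fin n} → p ∈₃ (x , y , z) → p ≢ x → p ≢ y → p ≡ z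
      third (inj₁ q)        p≢x _   = ⊥-elim (p≢x q)
      third (inj₂ (inj₁ q)) _   p≢y = ⊥-elim (p≢y q)
      third (inj₂ (inj₂ q)) _   _   = q

    Adj : Fin n → Fin n → Set
    Adj x y = ∃ λ z → E₃ x y z

    -- Having two edges is always used in this form: `p` is a candidate for the common vertex, and
    -- an edge through the pair that avoids it rules it out.
    Heavy : Fin n → Fin n → Set
    Heavy x y = ∀ p → ∃ λ z → z ≢ p × E₃ x y z

    Heavy-sym : ∀ {x y} → Heavy x y → Heavy y x
    Heavy-sym h p = let z , z≢p , e = h p in z , z≢p , edge-swap₁₂ H e

    Adj-sym : ∀ {x y} → Adj x y → Adj y x
    Adj-sym (z , e) = z , edge-swap₁₂ H e

    module _ (dfree : DFree H) where

      -- Each use splits on the membership of `p` in one well-chosen edge, which leaves three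
      -- candidates, and refutes or pins down each of them through others of the six edges.
      commonVertex₆ : ∀ {s₀ s₁ s₂ s₃ t₀₁ t₀₂ t₀₃ t₁₂ t₁₃ t₂₃} →
        E₃ s₀ s₁ t₀₁ → E₃ s₀ s₂ t₀₂ → E₃ s₀ s₃ t₀₃ → E₃ s₁ s₂ t₁₂ → E₃ s₁ s₃ t₁₃ → E₃ s₂ s₃ t₂₃ →
        ∃ λ p → p ∈₃ (s₀ , s₁ , t₀₁) × p ∈₃ (s₀ , s₂ , t₀₂) × p ∈₃ (s₀ , s₃ , t₀₃) ×
                p ∈₃ (s₁ , s₂ , t₁₂) × p ∈₃ (s₁ , s₃ , t₁₃) × p ∈₃ (s₂ , s₃ , t₂₃)
      commonVertex₆ {s₀} {s₁} {s₂} {s₃} e₀₁ e₀₂ e₀₃ e₁₂ e₁₃ e₂₃ =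
        case commonVertex H dfree (lookup (s₀ ∷ s₁ ∷ s₂ ∷ s₃ ∷ [])) _ ℕₚ.≤-refl
               (e₀₁ ∷ e₀₂ ∷ e₀₃ ∷ e₁₂ ∷ e₁₃ ∷ e₂₃ ∷ []) cover of λ
          { (p , m₀₁ ∷ m₀₂ ∷ m₀₃ ∷ m₁₂ ∷ m₁₃ ∷ m₂₃ ∷ []) → p , m₀₁ , m₀₂ , m₀₃ , m₁₂ , m₁₃ , m₂₃ }
        where
        cover : ∀ {i j : Fin 4} → i < j → _
        cover {zero}             {suc zero}             _ = _ , here refl
        cover {zero}             {suc (suc zero)}       _ = _ , there (here refl)
        cover {zero}             {suc (suc (suc zero))} _ = _ , there (there (here refl))
        cover {suc zero}         {suc (suc zero)}       _ = _ , there (there (there (here refl)))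
        cover {suc zero}         {suc (suc (suc zero))} _ = _ , there (there (there (there (here refl))))
        cover {suc (suc zero)}   {suc (suc (suc zero))} _ = _ , there (there (there (there (there (here refl)))))
        cover {suc zero}             {suc zero}       (s≤s ())
        cover {suc (suc zero)}       {suc zero}       (s≤s ())
        cover {suc (suc zero)}       {suc (suc zero)} (s≤s (s≤s ()))
        cover {suc (suc (suc zero))} {suc zero}       (s≤s ())
        cover {suc (suc (suc zero))} {suc (suc zero)} (s≤s (s≤s ()))
        cover {suc (suc (suc zero))} {suc (suc (suc zero))} (s≤s (s≤s (s≤s ())))

      -- z ∉ {a, b} and abx, aby, xyz ∈ H already cover {x, y, a, b} without a common vertex
      no-cross : ∀ {x y a b z} → E₃ x y z → E₃ a b x → E₃ a b y → z ≢ a → z ≢ b → ⊥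
      no-cross {x} {y} {a} {b} {z} xyz abx aby z≢a z≢b =
        case commonVertex₆ xyz (p312 abx) (p321 abx) (p312 aby) (p321 aby) abx of λ
          { (_ , inj₁ refl , _ , _ , m , _) →
              absurd m (edge⇒≢ H xyz) (≢-sym (edge⇒≢ H (p132 abx))) (≢-sym (edge⇒≢ H (p231 abx)))
          ; (_ , inj₂ (inj₁ refl) , m , _) →
              absurd m (≢-sym (edge⇒≢ H xyz)) (≢-sym (edge⇒≢ H (p132 aby))) (≢-sym (edge⇒≢ H (p231 aby)))
          ; (_ , inj₂ (inj₂ refl) , m , _) → absurd m (≢-sym (edge⇒≢ H (p132 xyz))) z≢a z≢b }

      -- Take an edge abw with w ≠ x. A common vertex of xya, xyb and abw other than a and b can
      -- only be y, with y = w. Then abx and aby are both edges, the situation of `no-cross`.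
      heavy-step : ∀ {x y a b z} → E₃ x y z → Heavy a b → E₃ a b x → E₃ x y a → E₃ x y b → z ≢ a → z ≢ b → ⊥
      heavy-step xyz hv abx xya xyb z≢a z≢b with hv _
      ... | w , w≢x , abw =
        case commonVertex₆ xyz (p132 xya) (p132 xyb) (p231 xya) (p231 xyb) abw of λ
          { (_ , _ , inj₁ refl , _ , _ , _ , m) →
              absurd m (edge⇒≢ H (p132 xya)) (edge⇒≢ H (p132 xyb)) (≢-sym w≢x)
          ; (_ , _ , inj₂ (inj₁ refl) , m , _) →
              absurd m (edge⇒≢ H (p312 xya)) (edge⇒≢ H abx) (edge⇒≢ H (p321 xya))
          ; (_ , _ , inj₂ (inj₂ refl) , _ , _ , _ , inj₁ y≡a) → edge⇒≢ H (p231 xya) y≡a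
          ; (_ , _ , inj₂ (inj₂ refl) , _ , _ , _ , inj₂ (inj₁ y≡b)) → edge⇒≢ H (p231 xyb) y≡b
          ; (_ , _ , inj₂ (inj₂ refl) , _ , _ , _ , inj₂ (inj₂ refl)) → no-cross xyz abx abw z≢a z≢b }

      -- If z is not in {a, b}, take an edge abw with w ≠ z. The common vertex lies in xyz and
      -- cannot be z, which is not in abw. If it is x, then w = x and the edges chosen for ya and yb
      -- both have third vertex x, as `heavy-step` requires; y is symmetric.
      heavy⇒third : ∀ {x y a b z} → E₃ x y z → Heavy a b → Adj x a → Adj x b → Adj y a → Adj y b →
        z ≡ a ⊎ z ≡ b
      heavy⇒third {x} {y} {a} {b} {z} xyz hv (_ , xa) (_ , xb) (_ , ya) (_ , yb) with z ≟ a | z ≟ b | hv z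
      ... | yes z≡a | _       | _ = inj₁ z≡a
      ... | no _    | yes z≡b | _ = inj₂ z≡b
      ... | no z≢a  | no z≢b  | w , w≢z , abw = ⊥-elim (case commonVertex₆ xyz xa xb ya yb abw of λ
          { (_ , inj₁ refl , _ , _ , m₁₂ , m₁₃ , m₂₃) →
              case third m₂₃ x≢a x≢b , third m₁₂ x≢y x≢a , third m₁₃ x≢y x≢b of λ
                { (refl , refl , refl) → heavy-step xyz hv abw (p312 ya) (p312 yb) z≢a z≢b }
          ; (_ , inj₂ (inj₁ refl) , m₀₂ , m₀₃ , _ , _ , m₂₃) →
              case third m₂₃ y≢a y≢b , third m₀₂ (≢-sym x≢y) y≢a , third m₀₃ (≢-sym x≢y) y≢b of λ
                { (refl , refl , refl) → heavy-step (p213 xyz) hv abw (p312 xa) (p312 xb) z≢a z≢b }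
          ; (_ , inj₂ (inj₂ refl) , _ , _ , _ , _ , m₂₃) → absurd m₂₃ z≢a z≢b (≢-sym w≢z) })
        where
        x≢y = edge⇒≢ H xyz
        x≢a = edge⇒≢ H xa
        x≢b = edge⇒≢ H xb
        y≢a = edge⇒≢ H ya
        y≢b = edge⇒≢ H yb

      -- The edges xab and xac cover all pairs of {x, a, b, c} but bc. Heaviness of bc then forces
      -- xbc to be an edge, heaviness of ab forces abc, and the four triples of a 4-set have no
      -- common vertex.
      two-edges : ∀ {x a b c} → Heavy a b → Heavy b c → E₃ x a b → E₃ x a c → ⊥
      two-edges {x} {a} {b} {c} hab hbc xab xac with hbc a | hab x
      ... | w , w≢a , bcw | v , v≢x , abv =
        case commonVertex₆ xab (p132 xab) (p132 xac) (p231 xab) (p231 xac) bcw of λ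
          { (_ , _ , inj₁ refl , _ , _ , _ , m) → case third m x≢b x≢c of λ { refl → step₂ (p312 bcw) }
          ; (_ , _ , inj₂ (inj₁ refl) , m , _) → absurd m (≢-sym x≢b) b≢c (≢-sym a≢b)
          ; (_ , _ , inj₂ (inj₂ refl) , _ , _ , _ , m) → absurd m a≢b a≢c (≢-sym w≢a) }
        where
        x≢b = edge⇒≢ H (p132 xab)
        x≢a = edge⇒≢ H xab
        x≢c = edge⇒≢ H (p132 xac)
        a≢b = edge⇒≢ H (p231 xab)
        a≢c = edge⇒≢ H (p231 xac)
        b≢c = edge⇒≢ H bcw

        step₃ : E₃ x b c → E₃ a b c → ⊥
        step₃ xbc abc = case commonVertex₆ xab xbc (p132 xac) abc (p132 abc) (p231 abc) of λ
          { (_ , _ , m , _ , inj₁ refl , _) → absurd m (≢-sym x≢a) a≢b a≢c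
          ; (_ , _ , _ , m , inj₂ (inj₁ refl) , _) → absurd m (≢-sym x≢b) b≢c (≢-sym a≢b)
          ; (_ , m , _ , _ , inj₂ (inj₂ refl) , _) → absurd m (≢-sym x≢c) (≢-sym a≢c) (≢-sym b≢c) }

        step₂ : E₃ x b c → ⊥
        step₂ xbc = case commonVertex₆ xac xbc (p132 xac) abv (p231 xac) (p231 xbc) of λ
          { (_ , inj₁ refl , _ , _ , m , _) → absurd m x≢a x≢b (≢-sym v≢x)
          ; (_ , inj₂ (inj₁ refl) , m , _) → absurd m (≢-sym x≢a) a≢b a≢c
          ; (_ , inj₂ (inj₂ refl) , _ , _ , m , _) →
              case third m (≢-sym a≢c) (≢-sym b≢c) of λ { refl → step₃ xbc abv } }

      -- By `heavy⇒third` the chosen edges through xa, xb and xc lie inside {x, a, b, c}. A single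
      -- triple covers only two of these pairs, so two different triples through x occur, and
      -- `two-edges` applies up to relabelling.
      no-heavy-K₄ : ∀ {x a b c} → Heavy a b → Heavy a c → Heavy b c → Adj x a → Adj x b → Adj x c → ⊥
      no-heavy-K₄ {x} {a} {b} {c} hab hac hbc (_ , xa) (_ , xb) (_ , xc)
        with heavy⇒third xc hab (_ , xa) (_ , xb) (Adj-sym ac) (Adj-sym bc)
           | heavy⇒third xb hac (_ , xa) (_ , xc) (Adj-sym ab) bc
           | heavy⇒third xa hbc (_ , xb) (_ , xc) ab ac
        where
        Heavy⇒Adj : ∀ {v w} → Heavy v w → Adj v w
        Heavy⇒Adj {v} h = let z , _ , e = h v in z , e
        ab = Heavy⇒Adj hab
        ac = Heavy⇒Adj hac
        bc = Heavy⇒Adj hbc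
      ... | inj₁ refl | inj₁ refl | _         = two-edges hab hbc (p132 xb) (p132 xc)
      ... | inj₁ refl | inj₂ refl | _         = two-edges (Heavy-sym hac) hab xc (p132 xb)
      ... | inj₂ refl | _         | inj₁ refl = two-edges (Heavy-sym hab) hac (p132 xa) (p132 xc)
      ... | inj₂ refl | _         | inj₂ refl = two-edges (Heavy-sym hac) hab (p132 xa) xc

  -- Disjoint triangles

  pick : {x : A} {L : List A} → x ∈ L → ∃ λ L′ →
    (∀ f → ∑ L f ≡ f x + ∑ L′ f) × (∀ {y} → y ∈ L → y ≢ x → y ∈ L′)
  pick {L = x ∷ L} (here refl) = L , (λ f → refl)
    , (λ { (here refl) y≢x → ⊥-elim (y≢x refl) ; (there y∈L) _ → y∈L })
  pick {x = x} {L = z ∷ L} (there x∈L) with pick x∈L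
  ... | L′ , split , keep = z ∷ L′
    , (λ f → trans (cong (f z +_) (split f)) (left-comm (f z) (f x) (∑ L′ f)))
    , (λ { (here refl) _ → here refl ; (there y∈L) y≢x → there (keep y∈L y≢x) })
    where
    left-comm : ∀ a b c → a + (b + c) ≡ b + (a + c)
    left-comm = solve-∀

  ∑-1 : (L : List A) → ∑ L (λ _ → 1) ≡ length L
  ∑-1 L = trans (∑-const L 1) (ℕₚ.*-identityʳ (length L))

  over : (A → ℕ) → A × A × A → ℕ
  over f (a , b , c) = f a + (f b + f c)

  over-mono : {f g : A → ℕ} → (∀ x → f x ≤ g x) → ∀ T → over f T ≤ over g T
  over-mono h (a , b , c) = ℕₚ.+-mono-≤ (h a) (ℕₚ.+-mono-≤ (h b) (h c))

  ∑∑-+ : {B : Set} (L : List A) (M : List B) (f g : A → B → ℕ) →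
    ∑ L (λ x → ∑ M (λ y → f x y + g x y)) ≡ ∑ L (λ x → ∑ M (f x)) + ∑ L (λ x → ∑ M (g x))
  ∑∑-+ L M f g = trans (∑-cong L λ x → ∑-+ M (f x) (g x)) (∑-+ L _ _)

  Triangle : ∀ {n} → (Fin n → Fin n → Bool) → Fin n × Fin n × Fin n → Set
  Triangle e (a , b , c) = e a b ≡ true × e a c ≡ true × e b c ≡ true

  -- Maximality is `restFree`. Quantifying `split` over `f` replaces a permutation of lists: `f`
  -- constantly 1 gives n = 3k + m, `f = δ z` gives disjointness, and an indicator of neighbours
  -- distributes a degree over the triangles and the rest.
  record Packing {n} (e : Fin n → Fin n → Bool) (L : List (Fin n)) : Set where
    field
      triangles : List (Fin n × Fin n × Fin n)
      rest      : List (Fin n)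
      areTriangles : All (Triangle e) triangles
      restFree  : ∀ {x y z} → x ∈ rest → y ∈ rest → z ∈ rest → ¬ Triangle e (x , y , z)
      split     : ∀ f → ∑ L f ≡ ∑ triangles (over f) + ∑ rest f

  packing : ∀ {n} (e : Fin n → Fin n → Bool) → (∀ {x y} → e x y ≡ true → x ≢ y) →
    (L : List (Fin n)) → Packing e L
  packing {n} e irrefl L = go (length L) L ℕₚ.≤-refl
    where
    go : ∀ k (L : List (Fin n)) → length L ≤ k → Packing e L
    go k L len with Any.any? (λ x → Any.any? (λ y → Any.any? (λ z →
      (e x y Boolₚ.≟ true) ×-dec ((e x z Boolₚ.≟ true) ×-dec (e y z Boolₚ.≟ true))) L) L) L
    ... | no ¬tri = record
      { triangles = [] ; rest = L ; areTriangles = []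
      ; restFree = λ x∈L y∈L z∈L t → ¬tri (lose x∈L (lose y∈L (lose z∈L t)))
      ; split = λ f → refl }
    ... | yes tri with find tri
    ... | x , x∈L , tri₁ with find tri₁
    ... | y , y∈L , tri₂ with find tri₂
    ... | z , z∈L , exy , exz , eyz with pick x∈L
    ... | L₁ , split₁ , keep₁ with pick (keep₁ y∈L (≢-sym (irrefl exy)))
    ... | L₂ , split₂ , keep₂ with pick (keep₂ (keep₁ z∈L (≢-sym (irrefl exz))) (≢-sym (irrefl eyz)))
    ... | L₃ , split₃ , _ = extend k len
      where
      split-xyz : ∀ f → ∑ L f ≡ over f (x , y , z) + ∑ L₃ f
      split-xyz f rewrite split₁ f | split₂ f | split₃ f = assoc (f x) (f y) (f z) _
        where
        assoc : ∀ a b c d → a + (b + (c + d)) ≡ a + (b + c) + d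
        assoc = solve-∀

      length-L : length L ≡ 3 + length L₃
      length-L = trans (sym (∑-1 L)) (trans (split-xyz (λ _ → 1)) (cong (3 +_) (∑-1 L₃)))

      extend : ∀ k → length L ≤ k → Packing e L
      extend zero    len with () ← subst (_≤ 0) length-L len
      extend (suc k) len = record
        { triangles = (x , y , z) ∷ triangles ; rest = rest
        ; areTriangles = (exy , exz , eyz) ∷ areTriangles ; restFree = restFree
        ; split = λ f → trans (split-xyz f) (trans (cong (over f (x , y , z) +_) (split f))
                          (sym (ℕₚ.+-assoc (over f (x , y , z)) _ _))) }
        where
        shorter : length L₃ ≤ k
        shorter = ℕₚ.≤-trans (ℕₚ.m≤n+m _ 2) (ℕ.s≤s⁻¹ (subst (_≤ suc k) length-L len))
        open Packing (go k L₃ shorter)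

  -- Mantel's theorem

  a≤b⇒2ab≤a²+b² : ∀ {a b} → a ≤ b → 2 * (a * b) ≤ a * a + b * b
  a≤b⇒2ab≤a²+b² {a} {b} a≤b = subst (λ b → 2 * (a * b) ≤ a * a + b * b) (ℕₚ.m+[n∸m]≡n a≤b)
    (subst (2 * (a * (a + (b ℕ.∸ a))) ≤_) (sym (expand a (b ℕ.∸ a))) (ℕₚ.m≤m+n _ _))
    where
    expand : ∀ a t → a * a + (a + t) * (a + t) ≡ 2 * (a * (a + t)) + t * t
    expand = solve-∀

  2ab≤a²+b² : ∀ a b → 2 * (a * b) ≤ a * a + b * b
  2ab≤a²+b² a b with ℕₚ.≤-total a b
  ... | inj₁ a≤b = a≤b⇒2ab≤a²+b² a≤b
  ... | inj₂ b≤a = subst₂ _≤_ (cong (2 *_) (ℕₚ.*-comm b a)) (ℕₚ.+-comm (b * b) (a * a)) (a≤b⇒2ab≤a²+b² b≤a)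

  -- Triangle-freeness gives d(y) + d(z) ≤ m for every edge yz, hence 2 ∑ d² ≤ m ∑ d; completing the
  -- square in 4 m d ≤ 4 d² + m² then bounds ∑ d.
  mantel : ∀ {A : Set} (R : List A) (e : A → A → Bool) → (∀ x y → e x y ≡ e y x) →
    (∀ {x y z} → x ∈ R → y ∈ R → z ∈ R → e x y ≡ true → e x z ≡ true → e y z ≡ true → ⊥) →
    2 * ∑ R (λ x → ∑ R λ y → ind (e x y)) ≤ length R * length R
  mantel {A} []      e e-comm free = z≤n
  -- The argument yields the inequality multiplied by `length R`; a nonempty list allows this factor
  -- to be cancelled.
  mantel {A} (r ∷ L) e e-comm free = ℕₚ.*-cancelˡ-≤ (length (r ∷ L)) (scaled (r ∷ L) free)
    where
    scaled : (R : List A) →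
      (∀ {x y z} → x ∈ R → y ∈ R → z ∈ R → e x y ≡ true → e x z ≡ true → e y z ≡ true → ⊥) →
      length R * (2 * ∑ R (λ x → ∑ R λ y → ind (e x y))) ≤ length R * (length R * length R)
    scaled R free = ℕₚ.+-cancelˡ-≤ (2 * (m * S)) _ _ (begin
      2 * (m * S) + m * (2 * S)        ≡⟨ regroup m S ⟩
      4 * m * S                        ≡⟨ sym (∑-*ˡ R (4 * m) deg) ⟩
      ∑ R (λ y → 4 * m * deg y)        ≤⟨ ∑-mono R (λ y → square m (deg y)) ⟩
      ∑ R (λ y → 4 * (deg y * deg y) + m * m)        ≡⟨ ∑-+ R _ _ ⟩
      ∑ R (λ y → 4 * (deg y * deg y)) + ∑ R (λ _ → m * m)        ≡⟨ cong₂ _+_ (∑-*ˡ R 4 _) (∑-const R (m * m)) ⟩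
      4 * Q + m * (m * m)              ≡⟨ cong (_+ m * (m * m)) (quadruple Q) ⟩
      2 * (Q + Q) + m * (m * m)        ≤⟨ ℕₚ.+-monoˡ-≤ (m * (m * m)) (ℕₚ.*-monoʳ-≤ 2 2Q≤mS) ⟩
      2 * (m * S) + m * (m * m)        ∎)
      where
      m = length R
      g : A → A → ℕ
      g x y = ind (e x y)
      deg : A → ℕ
      deg x = ∑ R (g x)
      S = ∑ R deg
      Q = ∑ R (λ y → deg y * deg y)

      regroup : ∀ m S → 2 * (m * S) + m * (2 * S) ≡ 4 * m * S
      regroup = solve-∀
      quadruple : ∀ Q → 4 * Q ≡ 2 * (Q + Q)
      quadruple = solve-∀

      square : ∀ m d → 4 * m * d ≤ 4 * (d * d) + m * m
      square m d = subst₂ _≤_ (lhs d m) (cong (_+ m * m) (rhs d)) (2ab≤a²+b² (2 * d) m)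
        where
        lhs : ∀ d m → 2 * (2 * d * m) ≡ 4 * m * d
        lhs = solve-∀
        rhs : ∀ d → 2 * d * (2 * d) ≡ 4 * (d * d)
        rhs = solve-∀

      deg²-sum : ∑ R (λ x → ∑ R λ y → ∑ R λ z → g x y * g y z) ≡ Q
      deg²-sum = trans (∑-cong R λ x → ∑-cong R λ y → ∑-*ˡ R (g x y) (g y))
        (trans (∑-swap R R _) (∑-cong R λ y → trans (∑-*ʳ R (λ x → g x y) (deg y))
          (cong (_* deg y) (∑-cong R λ x → cong ind (e-comm x y)))))

      edge-degrees : ∀ {x y z} → x ∈ R → y ∈ R → z ∈ R → g x y * g y z + g x z * g z y ≤ g y z
      edge-degrees {x} {y} {z} x∈ y∈ z∈ with e x y in xy | e x z in xz | e y z in yz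
      ... | true  | true  | true  = ⊥-elim (free x∈ y∈ z∈ xy xz yz)
      ... | true  | true  | false rewrite e-comm z y | yz = z≤n
      ... | true  | false | true  = s≤s z≤n
      ... | true  | false | false = z≤n
      ... | false | true  | true  rewrite e-comm z y | yz = s≤s z≤n
      ... | false | true  | false rewrite e-comm z y | yz = z≤n
      ... | false | false | _     = z≤n

      2Q≤mS : Q + Q ≤ m * S
      2Q≤mS = begin
        Q + Q  ≡⟨ cong₂ _+_ (sym deg²-sum) (sym (trans (∑-cong R λ x → ∑-swap R R _) deg²-sum)) ⟩
        _ ≡⟨ sym (trans (∑-cong R λ x → ∑∑-+ R R _ _) (∑-+ R _ _)) ⟩
        ∑ R (λ x → ∑ R λ y → ∑ R λ z → g x y * g y z + g x z * g z y)
          ≤⟨ ∑-mono-∈ R (λ x∈ → ∑-mono-∈ R λ y∈ → ∑-mono-∈ R λ z∈ → edge-degrees x∈ y∈ z∈) ⟩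
        ∑ R (λ x → S)  ≡⟨ ∑-const R S ⟩
        m * S ∎

  -- Counting against a maximal packing

  ind≤1 : ∀ b → ind b ≤ 1
  ind≤1 = byCases

  -- All that the counting uses of D-freeness. In `third-vertex` the vertex `z` is chosen from x and
  -- y alone, before a and b; this uniformity is what confines the agreement of x and y to a single
  -- triangle.
  record HeavyPairs {n} (adj heavy : Fin n → Fin n → Bool) : Set where
    field
      adj-sym      : ∀ {x y} → adj x y ≡ true → adj y x ≡ true
      heavy-sym    : ∀ {x y} → heavy x y ≡ true → heavy y x ≡ true
      heavy⇒adj    : ∀ {x y} → heavy x y ≡ true → adj x y ≡ true
      heavy⇒≢      : ∀ {x y} → heavy x y ≡ true → x ≢ y
      no-K₄        : ∀ {x a b c} → Triangle heavy (a , b , c) →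
                     adj x a ≡ true → adj x b ≡ true → adj x c ≡ true → ⊥
      third-vertex : ∀ {x y} → adj x y ≡ true → ∃ λ z → ∀ {a b} → heavy a b ≡ true →
                     adj x a ≡ true → adj x b ≡ true → adj y a ≡ true → adj y b ≡ true → z ≡ a ⊎ z ≡ b

  module Counting {n} {adj heavy : Fin n → Fin n → Bool} (hp : HeavyPairs adj heavy)
                  (P : Packing heavy (allFin n)) where
    open HeavyPairs hp
    open Packing P renaming (triangles to Ts; rest to R)

    private
      V = allFin n
      k = length Ts
      m = length R

      g g′ : Fin n → Fin n → ℕ
      g  x y = ind (adj x y)
      g′ x y = ind (heavy x y)

    heavy-comm : ∀ x y → heavy x y ≡ heavy y x
    heavy-comm x y with heavy x y in xy | heavy y x in yx
    ... | true  | true  = refl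
    ... | false | false = refl
    ... | true  | false = trans (sym (heavy-sym xy)) yx
    ... | false | true  = trans (sym xy) (heavy-sym yx)

    adj-comm : ∀ x y → adj x y ≡ adj y x
    adj-comm x y with adj x y in xy | adj y x in yx
    ... | true  | true  = refl
    ... | false | false = refl
    ... | true  | false = trans (sym (adj-sym xy)) yx
    ... | false | true  = trans (sym xy) (adj-sym yx)

    n≡3k+m : n ≡ 3 * k + m
    n≡3k+m = trans (sym (length-tabulate {n = n} (λ i → i))) (trans (sym (∑-1 V)) (trans (split (λ _ → 1))
      (cong₂ _+_ (trans (∑-const Ts 3) (ℕₚ.*-comm k 3)) (∑-1 R))))

    g′≤g : ∀ x y → g′ x y ≤ g x y
    g′≤g x y with heavy x y in xy
    ... | true  rewrite heavy⇒adj xy = s≤s z≤n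
    ... | false = z≤n

    over-adj≤2 : ∀ x {T} → T ∈ Ts → over (g x) T ≤ 2
    over-adj≤2 x {a , b , c} T∈ with adj x a in xa | adj x b in xb | adj x c in xc
    ... | true  | true  | true  = ⊥-elim (no-K₄ (All.lookup areTriangles T∈) xa xb xc)
    ... | true  | true  | false = ℕₚ.≤-refl
    ... | true  | false | u     = s≤s (ind≤1 u)
    ... | false | true  | u     = s≤s (ind≤1 u)
    ... | false | false | u     = ℕₚ.≤-trans (ind≤1 u) (s≤s z≤n)

    over-heavy≤2 : ∀ x {T} → T ∈ Ts → over (g′ x) T ≤ 2
    over-heavy≤2 x {T} T∈ = ℕₚ.≤-trans (over-mono (g′≤g x) T) (over-adj≤2 x T∈)

    ∑V-≤ : {f : Fin n → ℕ} (c : ℕ) → (∀ {T} → T ∈ Ts → over f T ≤ c) → ∑ V f ≤ k * c + ∑ R f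
    ∑V-≤ {f} c h = ℕₚ.≤-trans (ℕₚ.≤-reflexive (split f)) (ℕₚ.+-monoˡ-≤ (∑ R f) (∑-≤ Ts c h))

    ∑∑V-≤ : (L : List (Fin n)) (f : Fin n → Fin n → ℕ) (c : ℕ) → (∀ x {T} → T ∈ Ts → over (f x) T ≤ c) →
      ∑ L (λ x → ∑ V (f x)) ≤ length L * (k * c) + ∑ L (λ x → ∑ R (f x))
    ∑∑V-≤ L f c h = begin
      ∑ L (λ x → ∑ V (f x))                        ≤⟨ ∑-mono L (λ x → ∑V-≤ c (h x)) ⟩
      ∑ L (λ x → k * c + ∑ R (f x))                ≡⟨ ∑-+ L _ _ ⟩
      ∑ L (λ _ → k * c) + ∑ L (λ x → ∑ R (f x))    ≡⟨ cong (_+ ∑ L (λ x → ∑ R (f x))) (∑-const L (k * c)) ⟩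
      length L * (k * c) + ∑ L (λ x → ∑ R (f x))   ∎

    h : Fin n → Fin n → Fin n → ℕ
    h x y z = g′ x y * ind (heavy x z ∧ heavy y z)

    pairs : List (Fin n) → List (Fin n) → ℕ
    pairs L M = ∑ L λ x → ∑ M λ y → g′ x y

    tri : List (Fin n) → List (Fin n) → List (Fin n) → ℕ
    tri L M N = ∑ L λ x → ∑ M λ y → ∑ N λ z → h x y z

    h-swap₂₃ : ∀ x y z → h x y z ≡ h x z y
    h-swap₂₃ x y z rewrite heavy-comm z y = rearrange (heavy x y) (heavy x z) (heavy y z)
      where
      rearrange : ∀ p q r → ind p * ind (q ∧ r) ≡ ind q * ind (p ∧ r)
      rearrange = byCases

    h-swap₁₂ : ∀ x y z → h x y z ≡ h y x z
    h-swap₁₂ x y z rewrite heavy-comm y x | Boolₚ.∧-comm (heavy x z) (heavy y z) = refl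

    tri-swap₂₃ : ∀ L M N → tri L M N ≡ tri L N M
    tri-swap₂₃ L M N = trans (∑-cong L λ x → ∑-cong M λ y → ∑-cong N λ z → h-swap₂₃ x y z)
      (∑-cong L λ x → ∑-swap M N _)

    tri-swap₁₂ : ∀ L M N → tri L M N ≡ tri M L N
    tri-swap₁₂ L M N = trans (∑-cong L λ x → ∑-cong M λ y → ∑-cong N λ z → h-swap₁₂ x y z) (∑-swap L M _)

    pairs-comm : ∀ L M → pairs L M ≡ pairs M L
    pairs-comm L M = trans (∑-cong L λ x → ∑-cong M λ y → cong ind (heavy-comm x y)) (∑-swap L M _)

    -- If two vertices v and w of T both completed the heavy pair xy to a heavy triangle, then w
    -- would be adjacent to all three vertices of the heavy triangle xyv, against `no-K₄`.
    over-tri : ∀ x y {T} → T ∈ Ts → over (h x y) T ≤ g′ x y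
    over-tri x y {a , b , c} T∈ with heavy x y in xy
    ... | false = z≤n
    ... | true  = atMostOne _ _ _ (K₄ tab) (K₄ tac) (K₄ tbc)
      where
      tab = proj₁ (All.lookup areTriangles T∈)
      tac = proj₁ (proj₂ (All.lookup areTriangles T∈))
      tbc = proj₂ (proj₂ (All.lookup areTriangles T∈))

      K₄ : ∀ {v w} → heavy v w ≡ true → heavy x v ∧ heavy y v ≡ true → heavy x w ∧ heavy y w ≡ true → ⊥
      K₄ vw xyv xyw =
        let xv , yv = ∧-split xyv ; xw , yw = ∧-split xyw in
        no-K₄ (xy , xv , yv) (adj-sym (heavy⇒adj xw)) (adj-sym (heavy⇒adj yw)) (adj-sym (heavy⇒adj vw))

      atMostOne : ∀ p q r → (p ≡ true → q ≡ true → ⊥) → (p ≡ true → r ≡ true → ⊥) →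
        (q ≡ true → r ≡ true → ⊥) → 1 * ind p + (1 * ind q + 1 * ind r) ≤ 1
      atMostOne true  true  _     pq _  _  = ⊥-elim (pq refl refl)
      atMostOne true  false true  _  pr _  = ⊥-elim (pr refl refl)
      atMostOne true  false false _  _  _  = ℕₚ.≤-refl
      atMostOne false true  true  _  _  qr = ⊥-elim (qr refl refl)
      atMostOne false true  false _  _  _  = ℕₚ.≤-refl
      atMostOne false false true  _  _  _  = ℕₚ.≤-refl
      atMostOne false false false _  _  _  = z≤n

    tri-step : ∀ L M → tri L M V ≤ k * pairs L M + tri L M R
    tri-step L M = begin
      tri L M V  ≤⟨ ∑-mono L (λ x → ∑-mono M λ y → ∑V-≤ (g′ x y) (over-tri x y)) ⟩
      ∑ L (λ x → ∑ M λ y → k * g′ x y + ∑ R (h x y))  ≡⟨ ∑∑-+ L M _ _ ⟩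
      ∑ L (λ x → ∑ M λ y → k * g′ x y) + tri L M R
        ≡⟨ cong (_+ tri L M R) (trans (∑-cong L λ x → ∑-*ˡ M k (g′ x)) (∑-*ˡ L k _)) ⟩
      k * pairs L M + tri L M R  ∎

    tri-RRR : tri R R R ≡ 0
    tri-RRR = ∑-0 R λ x∈ → ∑-0 R λ y∈ → ∑-0 R λ z∈ → zero-term x∈ y∈ z∈
      where
      zero-term : ∀ {x y z} → x ∈ R → y ∈ R → z ∈ R → h x y z ≡ 0
      zero-term {x} {y} {z} x∈ y∈ z∈ with heavy x y in xy | heavy x z in xz | heavy y z in yz
      ... | true  | true  | true  = ⊥-elim (restFree x∈ y∈ z∈ (xy , xz , yz))
      ... | true  | true  | false = refl
      ... | true  | false | _     = refl
      ... | false | _     | _     = refl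

    -- The three coordinates are peeled off one at a time: by `over-tri`, a coordinate in the
    -- packing costs k times the remaining heavy pairs, and nothing is left once all three lie in
    -- `R`. Heavy pairs cost 2k per vertex, plus Mantel inside `R`. The triangles are ordered, and
    -- the factor 2 is that of `mantel`.
    heavyTriangles-≤ : 2 * tri V V V ≤ 12 * (k * k * k) + 12 * (k * k * m) + 3 * (k * (m * m))
    heavyTriangles-≤ = begin
      2 * tri V V V  ≤⟨ ℕₚ.*-monoʳ-≤ 2 tri-VVV ⟩
      2 * (k * VV + (k * VR + (k * RR + 0)))
        ≤⟨ ℕₚ.*-monoʳ-≤ 2 (ℕₚ.+-mono-≤ (ℕₚ.*-monoʳ-≤ k VV≤) (ℕₚ.+-monoˡ-≤ (k * RR + 0) (ℕₚ.*-monoʳ-≤ k VR≤))) ⟩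
      2 * (k * ((3 * k + m) * (k * 2) + (m * (k * 2) + RR)) + (k * (m * (k * 2) + RR) + (k * RR + 0)))
        ≡⟨ collect k m RR ⟩
      12 * (k * k * k) + 12 * (k * k * m) + 3 * (k * (2 * RR))
        ≤⟨ ℕₚ.+-monoʳ-≤ (12 * (k * k * k) + 12 * (k * k * m)) (ℕₚ.*-monoʳ-≤ 3 (ℕₚ.*-monoʳ-≤ k
             (mantel R heavy heavy-comm λ x∈ y∈ z∈ xy xz yz → restFree x∈ y∈ z∈ (xy , xz , yz)))) ⟩
      12 * (k * k * k) + 12 * (k * k * m) + 3 * (k * (m * m))  ∎
      where
      VV = pairs V V
      VR = pairs V R
      RR = pairs R R

      collect : ∀ k m r →
        2 * (k * ((3 * k + m) * (k * 2) + (m * (k * 2) + r)) + (k * (m * (k * 2) + r) + (k * r + 0)))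
          ≡ 12 * (k * k * k) + 12 * (k * k * m) + 3 * (k * (2 * r))
      collect = solve-∀

      VR≤ : VR ≤ m * (k * 2) + RR
      VR≤ = subst (_≤ m * (k * 2) + RR) (pairs-comm R V) (∑∑V-≤ R g′ 2 over-heavy≤2)

      VV≤ : VV ≤ (3 * k + m) * (k * 2) + (m * (k * 2) + RR)
      VV≤ = ℕₚ.≤-trans (∑∑V-≤ V g′ 2 over-heavy≤2)
        (ℕₚ.+-mono-≤ (ℕₚ.≤-reflexive (cong (_* (k * 2)) (trans (length-tabulate {n = n} (λ i → i)) n≡3k+m))) VR≤)

      tri-VVV : tri V V V ≤ k * VV + (k * VR + (k * RR + 0))
      tri-VVV = begin
        tri V V V            ≤⟨ tri-step V V ⟩
        k * VV + tri V V R   ≡⟨ cong (k * VV +_) (tri-swap₂₃ V V R) ⟩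
        k * VV + tri V R V   ≤⟨ ℕₚ.+-monoʳ-≤ (k * VV) (tri-step V R) ⟩
        k * VV + (k * VR + tri V R R)
          ≡⟨ cong (λ t → k * VV + (k * VR + t)) (trans (tri-swap₁₂ V R R) (tri-swap₂₃ R V R)) ⟩
        k * VV + (k * VR + tri R R V)
          ≤⟨ ℕₚ.+-monoʳ-≤ (k * VV) (ℕₚ.+-monoʳ-≤ (k * VR) (tri-step R R)) ⟩
        k * VV + (k * VR + (k * RR + tri R R R))
          ≡⟨ cong (λ t → k * VV + (k * VR + (k * RR + t))) tri-RRR ⟩
        k * VV + (k * VR + (k * RR + 0)) ∎

    -- A vertex x of the rest adjacent to exactly two vertices of T misses one of the three; otherwise x is
    -- deficient at T.  Two adjacent vertices missing the same vertex of T are both joined to the heavy pair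
    -- of the other two, so that pair contains the third vertex of an edge through them.  As the triangles
    -- are disjoint this happens for at most one T.

    Pattern = Bool → Bool → Bool → Bool

    misses₁ misses₂ misses₃ deficient : Pattern
    misses₁ p q r = not p ∧ q ∧ r
    misses₂ p q r = p ∧ not q ∧ r
    misses₃ p q r = p ∧ q ∧ not r
    deficient p q r = not (misses₁ p q r ∨ misses₂ p q r ∨ misses₃ p q r)

    at : Pattern → Fin n × Fin n × Fin n → Fin n → Bool
    at π (a , b , c) x = π (adj x a) (adj x b) (adj x c)

    agree : Fin n × Fin n × Fin n → Fin n → Fin n → ℕ
    agree T x y = ind (at misses₁ T x ∧ at misses₁ T y) +
      (ind (at misses₂ T x ∧ at misses₂ T y) + ind (at misses₃ T x ∧ at misses₃ T y))

    #miss₁ #miss₂ #miss₃ #deficient : Fin n × Fin n × Fin n → Fin n → ℕ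
    #miss₁ T x = ind (at misses₁ T x)
    #miss₂ T x = ind (at misses₂ T x)
    #miss₃ T x = ind (at misses₃ T x)
    #deficient T x = ind (at deficient T x)

    -- The complete 3-partite graph whose classes are the vertices missing the first, second and
    -- third vertex of T.
    cross : Fin n × Fin n × Fin n → Fin n → Fin n → ℕ
    cross T x y = #miss₁ T x * (#miss₂ T y + #miss₃ T y) +
      (#miss₂ T x * (#miss₁ T y + #miss₃ T y) + #miss₃ T x * (#miss₁ T y + #miss₂ T y))

    classify : ∀ T x y → g x y ≤ g x y * agree T x y + (cross T x y + (#deficient T x + #deficient T y))
    classify (a , b , c) x y =
      patterns (adj x y) (adj x a) (adj x b) (adj x c) (adj y a) (adj y b) (adj y c)
      where
      patterns : ∀ e p q r p′ q′ r′ → ind e ≤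
        ind e * (ind (misses₁ p q r ∧ misses₁ p′ q′ r′) +
          (ind (misses₂ p q r ∧ misses₂ p′ q′ r′) + ind (misses₃ p q r ∧ misses₃ p′ q′ r′))) +
        (ind (misses₁ p q r) * (ind (misses₂ p′ q′ r′) + ind (misses₃ p′ q′ r′)) +
          (ind (misses₂ p q r) * (ind (misses₁ p′ q′ r′) + ind (misses₃ p′ q′ r′)) +
           ind (misses₃ p q r) * (ind (misses₁ p′ q′ r′) + ind (misses₂ p′ q′ r′))) +
        (ind (deficient p q r) + ind (deficient p′ q′ r′)))
      patterns = byCases

    -- Bounding by the occurrences of z in T, rather than by 1, is what allows a sum over all
    -- triangles.
    agree≤δ : ∀ {x y z} → (∀ {a b} → heavy a b ≡ true →
        adj x a ≡ true → adj x b ≡ true → adj y a ≡ true → adj y b ≡ true → z ≡ a ⊎ z ≡ b) →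
      ∀ {T} → Triangle heavy T → agree T x y ≤ over (δ z) T
    agree≤δ {x} {y} {z} third {a , b , c} (ab , ac , bc) =
      exclusive (at misses₁ T x ∧ at misses₁ T y) (at misses₂ T x ∧ at misses₂ T y) (at misses₃ T x ∧ at misses₃ T y)
        (disjoint (adj x a) (adj x b) (adj x c) _ _ _) agree₁ agree₂ agree₃
      where
      T = (a , b , c)

      disjoint : ∀ p q r p′ q′ r′ →
        ind (misses₁ p q r ∧ p′) + (ind (misses₂ p q r ∧ q′) + ind (misses₃ p q r ∧ r′)) ≤ 1
      disjoint = byCases

      exclusive : ∀ p q r {N} → ind p + (ind q + ind r) ≤ 1 →
        (p ≡ true → 1 ≤ N) → (q ≡ true → 1 ≤ N) → (r ≡ true → 1 ≤ N) → ind p + (ind q + ind r) ≤ N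
      exclusive true  q     r     s h _ _ = ℕₚ.≤-trans s (h refl)
      exclusive false true  r     s _ h _ = ℕₚ.≤-trans s (h refl)
      exclusive false false true  s _ _ h = ℕₚ.≤-trans s (h refl)
      exclusive false false false _ _ _ _ = z≤n

      δ-at : ∀ {v} → z ≡ v → 1 ≤ δ z v
      δ-at refl = ℕₚ.≤-reflexive (sym (δ-≡ z))

      at-a : z ≡ a → 1 ≤ over (δ z) T
      at-a q = ℕₚ.m≤n⇒m≤n+o _ (δ-at q)
      at-b : z ≡ b → 1 ≤ over (δ z) T
      at-b q = ℕₚ.m≤n⇒m≤o+n (δ z a) (ℕₚ.m≤n⇒m≤n+o _ (δ-at q))
      at-c : z ≡ c → 1 ≤ over (δ z) T
      at-c q = ℕₚ.m≤n⇒m≤o+n (δ z a) (ℕₚ.m≤n⇒m≤o+n (δ z b) (δ-at q))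

      agree₁ : at misses₁ T x ∧ at misses₁ T y ≡ true → 1 ≤ over (δ z) T
      agree₁ h with ∧-split {at misses₁ T x} h
      ... | hx , hy with ∧-split {not (adj x a)} hx | ∧-split {not (adj y a)} hy
      ... | _ , hx | _ , hy with ∧-split {adj x b} hx | ∧-split {adj y b} hy
      ... | xb , xc | yb , yc = [ at-b , at-c ]′ (third bc xb xc yb yc)

      agree₂ : at misses₂ T x ∧ at misses₂ T y ≡ true → 1 ≤ over (δ z) T
      agree₂ h with ∧-split {at misses₂ T x} h
      ... | hx , hy with ∧-split {adj x a} hx | ∧-split {adj y a} hy
      ... | xa , hx | ya , hy with ∧-split {not (adj x b)} hx | ∧-split {not (adj y b)} hy
      ... | _ , xc | _ , yc = [ at-a , at-c ]′ (third ac xa xc ya yc)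

      agree₃ : at misses₃ T x ∧ at misses₃ T y ≡ true → 1 ≤ over (δ z) T
      agree₃ h with ∧-split {at misses₃ T x} h
      ... | hx , hy with ∧-split {adj x a} hx | ∧-split {adj y a} hy
      ... | xa , hx | ya , hy with ∧-split {adj x b} hx | ∧-split {adj y b} hy
      ... | xb , _ | yb , _ = [ at-a , at-b ]′ (third ab xa xb ya yb)

    ∑-agree≤1 : ∀ x y → ∑ Ts (λ T → g x y * agree T x y) ≤ 1
    ∑-agree≤1 x y with adj x y in xy
    ... | false = ℕₚ.≤-trans (ℕₚ.≤-reflexive (∑-0 Ts λ _ → refl)) z≤n
    ... | true  with third-vertex xy
    ... | z , third = begin
      ∑ Ts (λ T → 1 * agree T x y)       ≤⟨ ∑-mono-∈ Ts (λ T∈ → ℕₚ.≤-trans (ℕₚ.≤-reflexive (ℕₚ.*-identityˡ _))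
                                              (agree≤δ third (All.lookup areTriangles T∈))) ⟩
      ∑ Ts (over (δ z))                  ≤⟨ ℕₚ.m≤m+n _ _ ⟩
      -- Disjointness of the triangles enters here: z occurs only once in the whole vertex list.
      ∑ Ts (over (δ z)) + ∑ R (δ z)      ≡⟨ sym (split (δ z)) ⟩
      ∑ V (δ z)                          ≤⟨ ∑-allFin-δ z ⟩
      1 ∎

    ∑∑-* : {A B : Set} (L : List A) (M : List B) (f : A → ℕ) (u : B → ℕ) →
      ∑ L (λ x → ∑ M (λ y → f x * u y)) ≡ ∑ L f * ∑ M u
    ∑∑-* L M f u = trans (∑-cong L λ x → ∑-*ˡ M (f x) u) (∑-*ʳ L f (∑ M u))

    -- The Turán density 2/3 arises here: three classes of total size at most m span at most (2/3)m²
    -- ordered pairs across.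
    3cross≤2m² : ∀ T → 3 * ∑ R (λ x → ∑ R (cross T x)) ≤ 2 * (m * m)
    3cross≤2m² T = begin
      3 * ∑ R (λ x → ∑ R (cross T x))  ≡⟨ cong (3 *_) cross-sum ⟩
      3 * (α * (β + γ) + (β * (α + γ) + γ * (α + β)))  ≡⟨ expand α β γ ⟩
      4 * (α * β + α * γ + β * γ) + (2 * (α * β) + 2 * (α * γ) + 2 * (β * γ))
        ≤⟨ ℕₚ.+-monoʳ-≤ (4 * (α * β + α * γ + β * γ))
             (ℕₚ.+-mono-≤ (ℕₚ.+-mono-≤ (2ab≤a²+b² α β) (2ab≤a²+b² α γ)) (2ab≤a²+b² β γ)) ⟩
      4 * (α * β + α * γ + β * γ) + (α * α + β * β + (α * α + γ * γ) + (β * β + γ * γ))  ≡⟨ factor α β γ ⟩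
      2 * ((α + (β + γ)) * (α + (β + γ)))  ≤⟨ ℕₚ.*-monoʳ-≤ 2 (ℕₚ.*-mono-≤ α+β+γ≤m α+β+γ≤m) ⟩
      2 * (m * m) ∎
      where
      α = ∑ R (#miss₁ T)
      β = ∑ R (#miss₂ T)
      γ = ∑ R (#miss₃ T)

      expand : ∀ α β γ → 3 * (α * (β + γ) + (β * (α + γ) + γ * (α + β)))
        ≡ 4 * (α * β + α * γ + β * γ) + (2 * (α * β) + 2 * (α * γ) + 2 * (β * γ))
      expand = solve-∀
      factor : ∀ α β γ → 4 * (α * β + α * γ + β * γ) + (α * α + β * β + (α * α + γ * γ) + (β * β + γ * γ))
        ≡ 2 * ((α + (β + γ)) * (α + (β + γ)))
      factor = solve-∀

      product : ∀ (f u v : Fin n → ℕ) → ∑ R (λ x → ∑ R (λ y → f x * (u y + v y))) ≡ ∑ R f * (∑ R u + ∑ R v)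
      product f u v = trans (∑∑-* R R f _) (cong (∑ R f *_) (∑-+ R u v))

      cross-sum : ∑ R (λ x → ∑ R (cross T x)) ≡ α * (β + γ) + (β * (α + γ) + γ * (α + β))
      cross-sum = trans (∑∑-+ R R _ _) (cong₂ _+_ (product (#miss₁ T) (#miss₂ T) (#miss₃ T))
        (trans (∑∑-+ R R _ _) (cong₂ _+_ (product (#miss₂ T) (#miss₁ T) (#miss₃ T))
                                        (product (#miss₃ T) (#miss₁ T) (#miss₂ T)))))

      one-miss : ∀ p q r → ind (misses₁ p q r) + (ind (misses₂ p q r) + ind (misses₃ p q r)) ≤ 1
      one-miss = byCases

      α+β+γ≤m : α + (β + γ) ≤ m
      α+β+γ≤m = begin
        α + (β + γ)  ≡⟨ sym (trans (∑-+ R _ _) (cong (α +_) (∑-+ R _ _))) ⟩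
        ∑ R (λ x → #miss₁ T x + (#miss₂ T x + #miss₃ T x))
          ≤⟨ ∑-≤ R 1 (λ {x} _ → one-miss (adj x (proj₁ T)) (adj x (proj₁ (proj₂ T))) (adj x (proj₂ (proj₂ T)))) ⟩
        m * 1  ≡⟨ ℕₚ.*-identityʳ m ⟩
        m ∎

    private
      gVV gRR I : ℕ
      gVV = ∑ V λ x → ∑ V (g x)
      gRR = ∑ R λ x → ∑ R (g x)
      I = ∑ Ts λ T → ∑ R (#deficient T)

    -- `classify` summed over all triangles. Each ordered pair agrees at most once in total, which
    -- gives 3m²; each deficiency spoils m pairs in either position, which gives 6mI.
    3kRR≤ : k * (3 * gRR) ≤ 3 * (m * m) + (k * (2 * (m * m)) + 6 * (m * I))
    3kRR≤ = begin
      k * (3 * gRR)  ≡⟨ sym (∑-const Ts (3 * gRR)) ⟩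
      ∑ Ts (λ _ → 3 * gRR)  ≤⟨ ∑-mono Ts per-triangle ⟩
      ∑ Ts (λ T → 3 * agr T + (2 * (m * m) + 6 * (m * def T)))  ≡⟨ ∑-+ Ts _ _ ⟩
      ∑ Ts (λ T → 3 * agr T) + ∑ Ts (λ T → 2 * (m * m) + 6 * (m * def T))
        ≡⟨ cong₂ _+_ (∑-*ˡ Ts 3 agr) (∑-+ Ts _ _) ⟩
      3 * ∑ Ts agr + (∑ Ts (λ _ → 2 * (m * m)) + ∑ Ts (λ T → 6 * (m * def T)))
        ≡⟨ cong (3 * ∑ Ts agr +_) (cong₂ _+_ (∑-const Ts _) (trans (∑-*ˡ Ts 6 _) (cong (6 *_) (∑-*ˡ Ts m def)))) ⟩
      3 * ∑ Ts agr + (k * (2 * (m * m)) + 6 * (m * I))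
        ≤⟨ ℕₚ.+-monoˡ-≤ (k * (2 * (m * m)) + 6 * (m * I)) (ℕₚ.*-monoʳ-≤ 3 agreements) ⟩
      3 * (m * m) + (k * (2 * (m * m)) + 6 * (m * I)) ∎
      where
      agr def : Fin n × Fin n × Fin n → ℕ
      agr T = ∑ R λ x → ∑ R λ y → g x y * agree T x y
      def T = ∑ R (#deficient T)

      deficient-sum : ∀ T → ∑ R (λ x → ∑ R λ y → #deficient T x + #deficient T y) ≡ m * def T + m * def T
      deficient-sum T = trans (∑∑-+ R R _ _) (cong₂ _+_
        (trans (∑-cong R λ x → ∑-const R _) (∑-*ˡ R m _)) (∑-const R (def T)))

      regroup : ∀ a c d → 3 * (a + (c + (d + d))) ≡ 3 * a + (3 * c + 6 * d)
      regroup = solve-∀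

      per-triangle : ∀ T → 3 * gRR ≤ 3 * agr T + (2 * (m * m) + 6 * (m * def T))
      per-triangle T = begin
        3 * gRR  ≤⟨ ℕₚ.*-monoʳ-≤ 3 (∑-mono R λ x → ∑-mono R λ y → classify T x y) ⟩
        3 * ∑ R (λ x → ∑ R λ y → g x y * agree T x y + (cross T x y + (#deficient T x + #deficient T y)))
          ≡⟨ cong (3 *_) (trans (∑∑-+ R R _ _) (cong (agr T +_) (trans (∑∑-+ R R _ _)
               (cong (∑ R (λ x → ∑ R (cross T x)) +_) (deficient-sum T))))) ⟩
        3 * (agr T + (∑ R (λ x → ∑ R (cross T x)) + (m * def T + m * def T)))
          ≡⟨ regroup (agr T) (∑ R (λ x → ∑ R (cross T x))) (m * def T) ⟩
        3 * agr T + (3 * ∑ R (λ x → ∑ R (cross T x)) + 6 * (m * def T))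
          ≤⟨ ℕₚ.+-monoʳ-≤ (3 * agr T) (ℕₚ.+-monoˡ-≤ (6 * (m * def T)) (3cross≤2m² T)) ⟩
        3 * agr T + (2 * (m * m) + 6 * (m * def T)) ∎

      agreements : ∑ Ts agr ≤ m * m
      agreements = begin
        ∑ Ts agr  ≡⟨ trans (∑-swap Ts R _) (∑-cong R λ x → ∑-swap Ts R _) ⟩
        ∑ R (λ x → ∑ R λ y → ∑ Ts λ T → g x y * agree T x y)
          ≤⟨ ∑-≤ R m (λ {x} _ → ℕₚ.≤-trans (∑-≤ R 1 λ {y} _ → ∑-agree≤1 x y) (ℕₚ.≤-reflexive (ℕₚ.*-identityʳ m))) ⟩
        m * m ∎

    -- A deficient vertex is joined to at most one vertex of T instead of two, so every deficiency
    -- is regained as a missing adjacency.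
    RV+I≤ : ∑ R (λ x → ∑ V (g x)) + I ≤ m * (k * 2) + gRR
    RV+I≤ = begin
      ∑ R (λ x → ∑ V (g x)) + I
        ≡⟨ cong₂ _+_ (trans (∑-cong R λ x → split (g x)) (∑-+ R _ _)) (∑-swap Ts R _) ⟩
      PR + gRR + ∑ R (λ x → ∑ Ts λ T → #deficient T x)  ≡⟨ swap-last PR gRR _ ⟩
      PR + ∑ R (λ x → ∑ Ts λ T → #deficient T x) + gRR  ≡⟨ cong (_+ gRR) (sym (∑∑-+ R Ts _ _)) ⟩
      ∑ R (λ x → ∑ Ts λ T → over (g x) T + #deficient T x) + gRR
        ≤⟨ ℕₚ.+-monoˡ-≤ gRR (∑-≤ R (k * 2) λ {x} _ → ∑-≤ Ts 2 λ T∈ → slack x T∈) ⟩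
      m * (k * 2) + gRR ∎
      where
      PR = ∑ R λ x → ∑ Ts (over (g x))

      swap-last : ∀ a b c → a + b + c ≡ a + c + b
      swap-last = solve-∀

      slack : ∀ x {T} → T ∈ Ts → over (g x) T + #deficient T x ≤ 2
      slack x {a , b , c} T∈ = patterns (adj x a) (adj x b) (adj x c) (over-adj≤2 x T∈)
        where
        patterns : ∀ p q r → ind p + (ind q + ind r) ≤ 2 → ind p + (ind q + ind r) + ind (deficient p q r) ≤ 2
        patterns true  true  true  h = ⊥-elim (ℕₚ.<⇒≱ ℕₚ.≤-refl h)
        patterns true  true  false h = ℕₚ.≤-refl
        patterns true  false true  h = ℕₚ.≤-refl
        patterns true  false false h = ℕₚ.≤-refl
        patterns false true  true  h = ℕₚ.≤-refl
        patterns false true  false h = ℕₚ.≤-refl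
        patterns false false true  h = ℕₚ.≤-refl
        patterns false false false h = s≤s z≤n

    -- Deficiencies are credited 3kI by `RV+I≤` and charged 6mI by `3kRR≤`; 2m ≤ k makes the credit
    -- suffice. The other terms of order three add up to 2kn² exactly, as n = 3k + m.
    adjacentPairs-≤ : 2 * m ≤ k → 3 * (k * gVV) ≤ 2 * (k * (n * n)) + 3 * (m * m)
    adjacentPairs-≤ 2m≤k = ℕₚ.+-cancelʳ-≤ (3 * (k * I)) _ _ (begin
      3 * (k * gVV) + 3 * (k * I)
        ≤⟨ ℕₚ.+-monoˡ-≤ (3 * (k * I)) (ℕₚ.*-monoʳ-≤ 3 (ℕₚ.*-monoʳ-≤ k VV≤)) ⟩
      3 * (k * (n * (k * 2) + RV)) + 3 * (k * I)  ≡⟨ regroup k n RV I ⟩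
      3 * (k * (n * (k * 2))) + 3 * (k * (RV + I))
        ≤⟨ ℕₚ.+-monoʳ-≤ (3 * (k * (n * (k * 2)))) (ℕₚ.*-monoʳ-≤ 3 (ℕₚ.*-monoʳ-≤ k RV+I≤)) ⟩
      3 * (k * (n * (k * 2))) + 3 * (k * (m * (k * 2) + gRR))  ≡⟨ regroup′ k n m gRR ⟩
      6 * (k * k * (n + m)) + k * (3 * gRR)  ≤⟨ ℕₚ.+-monoʳ-≤ (6 * (k * k * (n + m))) 3kRR≤ ⟩
      6 * (k * k * (n + m)) + (3 * (m * m) + (k * (2 * (m * m)) + 6 * (m * I)))
        ≡⟨ cong (λ n → 6 * (k * k * (n + m)) + (3 * (m * m) + (k * (2 * (m * m)) + 6 * (m * I)))) n≡3k+m ⟩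
      6 * (k * k * (3 * k + m + m)) + (3 * (m * m) + (k * (2 * (m * m)) + 6 * (m * I)))  ≡⟨ collect k m I ⟩
      2 * (k * ((3 * k + m) * (3 * k + m))) + 3 * (m * m) + 3 * (2 * m * I)
        ≡⟨ cong (λ n → 2 * (k * (n * n)) + 3 * (m * m) + 3 * (2 * m * I)) (sym n≡3k+m) ⟩
      2 * (k * (n * n)) + 3 * (m * m) + 3 * (2 * m * I)
        ≤⟨ ℕₚ.+-monoʳ-≤ (2 * (k * (n * n)) + 3 * (m * m)) (ℕₚ.*-monoʳ-≤ 3 (ℕₚ.*-monoˡ-≤ I 2m≤k)) ⟩
      2 * (k * (n * n)) + 3 * (m * m) + 3 * (k * I) ∎)
      where
      RV = ∑ R (λ x → ∑ V (g x))

      VV≤ : gVV ≤ n * (k * 2) + RV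
      VV≤ = ℕₚ.≤-trans (∑∑V-≤ V g 2 over-adj≤2) (ℕₚ.≤-reflexive (cong₂ _+_
        (cong (_* (k * 2)) (length-tabulate {n = n} (λ i → i)))
        (trans (∑-swap V R _) (∑-cong R λ x → ∑-cong V λ y → cong ind (adj-comm y x)))))

      regroup : ∀ k n r i → 3 * (k * (n * (k * 2) + r)) + 3 * (k * i) ≡ 3 * (k * (n * (k * 2))) + 3 * (k * (r + i))
      regroup = solve-∀
      regroup′ : ∀ k n m r → 3 * (k * (n * (k * 2))) + 3 * (k * (m * (k * 2) + r)) ≡ 6 * (k * k * (n + m)) + k * (3 * r)
      regroup′ = solve-∀
      collect : ∀ k m i → 6 * (k * k * (3 * k + m + m)) + (3 * (m * m) + (k * (2 * (m * m)) + 6 * (m * i)))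
        ≡ 2 * (k * ((3 * k + m) * (3 * k + m))) + 3 * (m * m) + 3 * (2 * m * i)
      collect = solve-∀

  -- Ordered counts in a 3-graph

  not-both : ∀ {n} (x y : Fin n) → ind (x <F y ∧ y <F x) ≡ 0
  not-both x y with x <F y in xy
  ... | false = refl
  ... | true rewrite <F-asym x y xy = refl

  not-cyclic : ∀ {n} (x y z : Fin n) → ind (x <F y ∧ y <F z ∧ z <F x) ≡ 0
  not-cyclic x y z with x <F y in xy | y <F z in yz
  ... | false | _     = refl
  ... | true  | false = refl
  ... | true  | true  rewrite <F-asym x z (<F-trans x y z xy yz) = refl

  module _ {n} (H : Graph3 n) where

    private
      V = allFin n

      ∣V∣ : length V ≡ n
      ∣V∣ = length-tabulate id

    adj : Fin n → Fin n → Bool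
    adj x y = anyFin n (edge H x y)

    codeg : Fin n → Fin n → ℕ
    codeg x y = ∑ V λ z → ind (edge H x y z)

    heavy : Fin n → Fin n → Bool
    heavy x y = 1 ℕ.<ᵇ codeg x y

    adj⇒Adj : ∀ {x y} → adj x y ≡ true → Adj H x y
    adj⇒Adj h = let z , e = anyFin-sound h in z , mkEdge e

    Adj⇒adj : ∀ {x y} → Adj H x y → adj x y ≡ true
    Adj⇒adj (z , mkEdge e) = anyFin-complete {i = z} e

    edge-comm₁₂ : ∀ x y z → edge H x y z ≡ edge H y x z
    edge-comm₁₂ x y z = Boolₚ.⇔→≡ (mk⇔ (λ e → IsEdge.holds (edge-swap₁₂ H (mkEdge {x = x} {y} {z} e)))
                                      (λ e → IsEdge.holds (edge-swap₁₂ H (mkEdge {x = y} {x} {z} e))))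

    edge-comm₂₃ : ∀ x y z → edge H x y z ≡ edge H x z y
    edge-comm₂₃ x y z = Boolₚ.⇔→≡ (mk⇔ (λ e → IsEdge.holds (edge-swap₂₃ H (mkEdge {x = x} {y} {z} e)))
                                      (λ e → IsEdge.holds (edge-swap₂₃ H (mkEdge {x = x} {z} {y} e))))

    heavy⇒Heavy : ∀ {x y} → heavy x y ≡ true → Heavy H x y
    heavy⇒Heavy {x} {y} h p with any? (λ z → ¬? (z ≟ p) ×-dec (edge H x y z Boolₚ.≟ true))
    ... | yes (z , z≢p , e) = z , z≢p , mkEdge e
    ... | no ¬w = ⊥-elim (ℕₚ.<⇒≱ (ℕₚ.<ᵇ⇒< 1 (codeg x y) (subst IsTrue (sym h) _)) codeg≤1)
      where
      only-p : ∀ z → ind (edge H x y z) ≤ δ p z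
      only-p z with edge H x y z in e | z ≟ p
      ... | true  | yes _   = s≤s z≤n
      ... | true  | no  z≢p = ⊥-elim (¬w (z , z≢p , e))
      ... | false | _       = z≤n

      codeg≤1 : codeg x y ≤ 1
      codeg≤1 = ℕₚ.≤-trans (∑-mono V only-p) (∑-allFin-δ p)

    adj-symmetric : ∀ x y → adj x y ≡ true → adj y x ≡ true
    adj-symmetric x y h = Adj⇒adj {y} {x} (Adj-sym H (adj⇒Adj {x} {y} h))

    heavyPairs : DFree H → HeavyPairs adj heavy
    heavyPairs dfree = record
      { adj-sym      = λ {x} {y} → adj-symmetric x y
      ; heavy-sym    = λ {x} {y} h → trans (cong (1 ℕ.<ᵇ_) (∑-cong V λ z → cong ind (edge-comm₁₂ y x z))) h
      ; heavy⇒adj    = λ {x} {y} h → let z , _ , e = heavy⇒Heavy {x} {y} h x in Adj⇒adj {x} {y} (z , e)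
      ; heavy⇒≢      = λ {x} {y} h → let _ , _ , e = heavy⇒Heavy {x} {y} h x in edge⇒≢ H e
      ; no-K₄        = λ {x} {a} {b} {c} (ab , ac , bc) xa xb xc → no-heavy-K₄ H dfree {x} {a} {b} {c}
                         (heavy⇒Heavy ab) (heavy⇒Heavy ac) (heavy⇒Heavy bc) (adj⇒Adj xa) (adj⇒Adj xb) (adj⇒Adj xc)
      ; third-vertex = λ {x} {y} xy → let z , e = adj⇒Adj {x} {y} xy in z , λ {a} {b} ab xa xb ya yb →
                         heavy⇒third H dfree {x} {y} {a} {b} e (heavy⇒Heavy ab) (adj⇒Adj xa) (adj⇒Adj xb) (adj⇒Adj ya) (adj⇒Adj yb)
      }

    2shadow≤ : 2 * shadowSize H ≤ ∑ V (λ x → ∑ V λ y → ind (adj x y))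
    2shadow≤ = begin
      2 * shadowSize H  ≡⟨ cong (shadowSize H +_) (ℕₚ.+-identityʳ _) ⟩
      shadowSize H + shadowSize H  ≡⟨ cong (shadowSize H +_) (∑-swap V V _) ⟩
      shadowSize H + ∑ V (λ a → ∑ V λ b → ind (b <F a ∧ adj b a))  ≡⟨ sym (∑∑-+ V V _ _) ⟩
      ∑ V (λ a → ∑ V λ b → ind (a <F b ∧ adj a b) + ind (b <F a ∧ adj b a))
        ≤⟨ ∑-mono V (λ a → ∑-mono V λ b → one-order a b) ⟩
      ∑ V (λ x → ∑ V λ y → ind (adj x y)) ∎
      where
      -- The comparisons become independent Booleans; the impossible case that both hold is charged
      -- to a term that `not-both` makes zero.
      cases : ∀ p p′ e → ind (p ∧ e) + ind (p′ ∧ e) ≤ ind e + ind (p ∧ p′)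
      cases = byCases

      one-order : ∀ a b → ind (a <F b ∧ adj a b) + ind (b <F a ∧ adj b a) ≤ ind (adj a b)
      one-order a b = subst₂ _≤_
        (cong (λ e → ind (a <F b ∧ adj a b) + ind (b <F a ∧ e))
          (Boolₚ.⇔→≡ (mk⇔ (adj-symmetric a b) (adj-symmetric b a))))
        (trans (cong (ind (adj a b) +_) (not-both a b)) (ℕₚ.+-identityʳ _))
        (cases (a <F b) (b <F a) (adj a b))

    sorted : Fin n → Fin n → Fin n → ℕ
    sorted a b c = ind (a <F b ∧ b <F c ∧ H a b c)

    #ordered : ℕ
    #ordered = sumFin³ λ x y z → ind (edge H x y z)

    6size≤ : 6 * size H ≤ #ordered
    6size≤ = begin
      6 * s  ≡⟨ six s ⟩
      s + (s + (s + (s + (s + s))))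
        ≡⟨ cong (s +_) (cong₂ _+_ acb (cong₂ _+_ bac (cong₂ _+_ bca (cong₂ _+_ cab cba)))) ⟩
      sumFin³ sorted + (sumFin³ s₂ + (sumFin³ s₃ + (sumFin³ s₄ + (sumFin³ s₅ + sumFin³ s₆))))
        ≡⟨ sym (trans (sumFin³-+ sorted _) (cong (s +_) (trans (sumFin³-+ s₂ _) (cong (sumFin³ s₂ +_)
            (trans (sumFin³-+ s₃ _) (cong (sumFin³ s₃ +_) (trans (sumFin³-+ s₄ _) (cong (sumFin³ s₄ +_) (sumFin³-+ s₅ s₆))))))))) ⟩
      sumFin³ (λ a b c → sorted a b c + (s₂ a b c + (s₃ a b c + (s₄ a b c + (s₅ a b c + s₆ a b c)))))
        ≤⟨ sumFin³-mono one-order ⟩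
      #ordered ∎
      where
      s₂ s₃ s₄ s₅ s₆ : Fin n → Fin n → Fin n → ℕ
      s₂ a b c = sorted a c b
      s₃ a b c = sorted b a c
      s₄ a b c = sorted b c a
      s₅ a b c = sorted c a b
      s₆ a b c = sorted c b a

      s = size H
      six : ∀ s → 6 * s ≡ s + (s + (s + (s + (s + s))))
      six = solve-∀

      swap₁₂ : (f : Fin n → Fin n → Fin n → ℕ) → sumFin³ f ≡ sumFin³ (λ a b c → f b a c)
      swap₁₂ f = ∑-swap V V _
      swap₂₃ : (f : Fin n → Fin n → Fin n → ℕ) → sumFin³ f ≡ sumFin³ (λ a b c → f a c b)
      swap₂₃ f = ∑-cong V λ a → ∑-swap V V _

      acb : s ≡ sumFin³ s₂
      acb = swap₂₃ sorted
      bac : s ≡ sumFin³ s₃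
      bac = swap₁₂ sorted
      bca : s ≡ sumFin³ s₄
      bca = trans acb (swap₁₂ s₂)
      cab : s ≡ sumFin³ s₅
      cab = trans bac (swap₂₃ s₃)
      cba : s ≡ sumFin³ s₆
      cba = trans cab (swap₁₂ s₅)

      ordered : ∀ {x y z} a b c → Perm₃ a b c x y z → sorted a b c ≤ ind (a <F b ∧ b <F c) * ind (edge H x y z)
      ordered {x} {y} {z} a b c π with a <F b in ab | b <F c in bc | H a b c in h
      ... | false | _     | _     = z≤n
      ... | true  | false | _     = z≤n
      ... | true  | true  | false = z≤n
      ... | true  | true  | true
        rewrite IsEdge.holds (sorted⇒edge H {x} {y} {z} (a , b , c , (ab , bc) , h , π)) = s≤s z≤n

      -- Independent Booleans again. The defect terms are the contradictory pairs of comparisons and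
      -- the two cyclic patterns, all zero for actual vertices; the factor 6 covers all six orders
      -- holding at once.
      one-of-six : ∀ p p′ q q′ r r′ →
        ind (p ∧ q) + (ind (r ∧ q′) + (ind (p′ ∧ r) + (ind (q ∧ r′) + (ind (r′ ∧ p) + ind (q′ ∧ p′))))) ≤
        1 + 6 * (ind (p ∧ p′) + (ind (q ∧ q′) + (ind (r ∧ r′) + (ind (p ∧ q ∧ r′) + ind (q′ ∧ p′ ∧ r)))))
      one-of-six = byCases

      one-order : ∀ a b c →
        sorted a b c + (sorted a c b + (sorted b a c + (sorted b c a + (sorted c a b + sorted c b a))))
        ≤ ind (edge H a b c)
      one-order a b c = begin
        _ ≤⟨ ℕₚ.+-mono-≤ (ordered a b c perm-abc) (ℕₚ.+-mono-≤ (ordered a c b perm-acb) (ℕₚ.+-mono-≤ (ordered b a c perm-bac)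
               (ℕₚ.+-mono-≤ (ordered b c a perm-cab) (ℕₚ.+-mono-≤ (ordered c a b perm-bca) (ordered c b a perm-cba))))) ⟩
        _ ≡⟨ factor (ind (a <F b ∧ b <F c)) (ind (a <F c ∧ c <F b)) (ind (b <F a ∧ a <F c))
               (ind (b <F c ∧ c <F a)) (ind (c <F a ∧ a <F b)) (ind (c <F b ∧ b <F a)) (ind (edge H a b c)) ⟩
        _ ≤⟨ ℕₚ.*-monoˡ-≤ (ind (edge H a b c)) (ℕₚ.≤-trans (one-of-six (a <F b) (b <F a) (b <F c) (c <F b) (a <F c) (c <F a))
               (ℕₚ.≤-reflexive no-defect)) ⟩
        1 * ind (edge H a b c)  ≡⟨ ℕₚ.*-identityˡ _ ⟩
        ind (edge H a b c) ∎
        where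
        factor : ∀ u v w x y z e → u * e + (v * e + (w * e + (x * e + (y * e + z * e)))) ≡ (u + (v + (w + (x + (y + z))))) * e
        factor = solve-∀

        no-defect : _ ≡ 1
        no-defect = cong (λ t → 1 + 6 * t) (cong₂ _+_ (not-both a b) (cong₂ _+_ (not-both b c)
          (cong₂ _+_ (not-both a c) (cong₂ _+_ (not-cyclic a b c) (not-cyclic c b a)))))

    light-degree : ∀ x y → ∑ V (λ z → ind (edge H x y z ∧ not (heavy x y))) ≤ 1
    light-degree x y with 1 ℕ.<ᵇ codeg x y in h
    ... | true  = ℕₚ.≤-trans (ℕₚ.≤-reflexive (∑-0 V λ {z} _ → cong ind (Boolₚ.∧-zeroʳ (edge H x y z)))) z≤n
    ... | false = ℕₚ.≤-trans (ℕₚ.≤-reflexive (∑-cong V λ z → cong ind (Boolₚ.∧-identityʳ (edge H x y z))))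
                    (ℕₚ.≮⇒≥ λ 1<codeg → subst IsTrue h (ℕₚ.<⇒<ᵇ 1<codeg))

    heavyTriangle : Fin n → Fin n → Fin n → ℕ
    heavyTriangle x y z = ind (heavy x y) * ind (heavy x z ∧ heavy y z)

    #heavyTriangles : ℕ
    #heavyTriangles = sumFin³ heavyTriangle

    light≤ : sumFin³ (λ x y z → ind (edge H x y z ∧ not (heavy x y))) ≤ n * n
    light≤ = begin
      sumFin³ (λ x y z → ind (edge H x y z ∧ not (heavy x y)))
        ≤⟨ ∑-≤ V n (λ {x} _ → ℕₚ.≤-trans (∑-≤ V 1 λ {y} _ → light-degree x y)
             (ℕₚ.≤-reflexive (trans (ℕₚ.*-identityʳ (length V)) ∣V∣))) ⟩
      length V * n  ≡⟨ cong (_* n) ∣V∣ ⟩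
      n * n ∎

    -- An edge is a heavy triangle unless one of its three pairs is light. A light pair lies in at
    -- most one edge, so each of the three positions accounts for at most n² ordered edges.
    ordered≤ : #ordered ≤ #heavyTriangles + 3 * (n * n)
    ordered≤ = begin
      #ordered  ≤⟨ sumFin³-mono (λ x y z → split (edge H x y z) (heavy x y) (heavy x z) (heavy y z)) ⟩
      sumFin³ (λ x y z → heavyTriangle x y z + (l₁ x y z + (l₂ x y z + l₃ x y z)))
        ≡⟨ trans (sumFin³-+ heavyTriangle _) (cong (#heavyTriangles +_) (trans (sumFin³-+ l₁ _) (cong (sumFin³ l₁ +_) (sumFin³-+ l₂ l₃)))) ⟩
      #heavyTriangles + (sumFin³ l₁ + (sumFin³ l₂ + sumFin³ l₃))
        ≡⟨ cong (λ t → #heavyTriangles + (sumFin³ l₁ + t)) (cong₂ _+_ l₂≡l₁ l₃≡l₁) ⟩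
      #heavyTriangles + (sumFin³ l₁ + (sumFin³ l₁ + sumFin³ l₁))
        ≤⟨ ℕₚ.+-monoʳ-≤ #heavyTriangles (ℕₚ.+-mono-≤ light≤ (ℕₚ.+-mono-≤ light≤ light≤)) ⟩
      #heavyTriangles + (n * n + (n * n + n * n))  ≡⟨ cong (#heavyTriangles +_) (three (n * n)) ⟩
      #heavyTriangles + 3 * (n * n) ∎
      where
      three : ∀ a → a + (a + a) ≡ 3 * a
      three = solve-∀

      l₁ l₂ l₃ : Fin n → Fin n → Fin n → ℕ
      l₁ x y z = ind (edge H x y z ∧ not (heavy x y))
      l₂ x y z = ind (edge H x y z ∧ not (heavy x z))
      l₃ x y z = ind (edge H x y z ∧ not (heavy y z))

      l₂≡l₁ : sumFin³ l₂ ≡ sumFin³ l₁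
      l₂≡l₁ = ∑-cong V λ x → trans (∑-swap V V _) (∑-cong V λ z → ∑-cong V λ y →
        cong (λ e → ind (e ∧ not (heavy x z))) (edge-comm₂₃ x y z))

      l₃≡l₁ : sumFin³ l₃ ≡ sumFin³ l₁
      l₃≡l₁ = trans (trans (∑-swap V V _) (∑-cong V λ y → ∑-swap V V _)) (∑-cong V λ y → ∑-cong V λ z → ∑-cong V λ x →
        cong (λ e → ind (e ∧ not (heavy y z))) (trans (edge-comm₁₂ x y z) (edge-comm₂₃ y x z)))

      split : ∀ e p q r → ind e ≤ ind p * ind (q ∧ r) +
        (ind (e ∧ not p) + (ind (e ∧ not q) + ind (e ∧ not r)))
      split = byCases

  -- Numerical bounds

  -- Division by k, with m² ≤ kn because m ≤ k and m ≤ n. The case k = 0 is void: it forces m = 0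
  -- and hence n = 0.
  shadow-arithmetic : ∀ {k m n s} → n ≡ 3 * k + m → 1 ≤ n → 2 * m ≤ k →
    3 * (k * (2 * s)) ≤ 2 * (k * (n * n)) + 3 * (m * m) → 6 * s ≤ 2 * (n * n) + 3 * n
  shadow-arithmetic {zero}  {zero}  refl () _ _
  shadow-arithmetic {zero}  {suc m} _ _ () _
  shadow-arithmetic {suc k-1} {m} {n} {s} n≡ _ 2m≤k bound = ℕₚ.*-cancelˡ-≤ k (begin
    k * (6 * s)  ≡⟨ regroup k s ⟩
    3 * (k * (2 * s))  ≤⟨ bound ⟩
    2 * (k * (n * n)) + 3 * (m * m)
      ≤⟨ ℕₚ.+-monoʳ-≤ (2 * (k * (n * n))) (ℕₚ.*-monoʳ-≤ 3 (ℕₚ.*-mono-≤ m≤k m≤n)) ⟩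
    2 * (k * (n * n)) + 3 * (k * n)  ≡⟨ distribute k n ⟩
    k * (2 * (n * n) + 3 * n) ∎)
    where
    k = suc k-1
    m≤k : m ≤ k
    m≤k = ℕₚ.≤-trans (ℕₚ.m≤m+n m _) 2m≤k
    m≤n : m ≤ n
    m≤n = subst (m ≤_) (sym n≡) (ℕₚ.m≤n+m m (3 * k))
    regroup : ∀ k s → k * (6 * s) ≡ 3 * (k * (2 * s))
    regroup = solve-∀
    distribute : ∀ k n → 2 * (k * (n * n)) + 3 * (k * n) ≡ k * (2 * (n * n) + 3 * n)
    distribute = solve-∀

  -- 343 m³ ≥ n³ and 343 · 162 = 6 · 9261
  size-arithmetic : ∀ {k m n s} → n ≡ 3 * k + m → 9261 ≤ n → k ≤ 2 * m →
    12 * s ≤ 12 * (k * k * k) + 12 * (k * k * m) + 3 * (k * (m * m)) + 6 * (n * n) →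
    18522 * s ≤ 685 * (n * n * n)
  size-arithmetic {k} {m} {n} {s} n≡ n-large k≤2m bound = ℕₚ.*-cancelˡ-≤ 6 (ℕₚ.+-cancelʳ-≤ (12 * N³) _ _ (begin
    6 * (18522 * s) + 12 * N³
      ≡⟨ cong (_+ 12 * N³) (trans (sym (ℕₚ.*-assoc 6 18522 s)) (ℕₚ.*-assoc 343 324 s)) ⟩
    343 * (324 * s) + 12 * N³  ≤⟨ ℕₚ.+-monoʳ-≤ (343 * (324 * s)) (ℕₚ.*-monoʳ-≤ 12 n³≤343m³) ⟩
    343 * (324 * s) + 12 * (343 * M³)  ≡⟨ factor 343 s M³ ⟩
    343 * (324 * s + 12 * M³)  ≤⟨ ℕₚ.*-monoʳ-≤ 343 step ⟩
    343 * (12 * N³ + 162 * (n * n))  ≡⟨ ℕₚ.*-distribˡ-+ 343 (12 * N³) (162 * (n * n)) ⟩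
    343 * (12 * N³) + 343 * (162 * (n * n))
      ≡⟨ cong₂ _+_ (sym (ℕₚ.*-assoc 343 12 N³)) (trans (sym (ℕₚ.*-assoc 343 162 (n * n))) (ℕₚ.*-assoc 6 9261 (n * n))) ⟩
    4116 * N³ + 6 * (9261 * (n * n))
      ≤⟨ ℕₚ.+-monoʳ-≤ (4116 * N³) (ℕₚ.*-monoʳ-≤ 6 (ℕₚ.*-monoˡ-≤ (n * n) n-large)) ⟩
    4116 * N³ + 6 * (n * (n * n))  ≡⟨ cong (λ t → 4116 * N³ + 6 * t) (sym (ℕₚ.*-assoc n n n)) ⟩
    4116 * N³ + 6 * N³  ≡⟨ sym (ℕₚ.*-distribʳ-+ N³ 4116 6) ⟩
    4122 * N³  ≡⟨ ℕₚ.*-distribʳ-+ N³ 4110 12 ⟩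
    4110 * N³ + 12 * N³  ≡⟨ cong (_+ 12 * N³) (ℕₚ.*-assoc 6 685 N³) ⟩
    6 * (685 * N³) + 12 * N³ ∎))
    where
    N³ = n * n * n
    M³ = m * m * m

    factor : ∀ c s t → c * (324 * s) + 12 * (c * t) ≡ c * (324 * s + 12 * t)
    factor = solve-∀

    n≤7m : n ≤ 7 * m
    n≤7m = begin
      n            ≡⟨ n≡ ⟩
      3 * k + m    ≤⟨ ℕₚ.+-monoˡ-≤ m (ℕₚ.*-monoʳ-≤ 3 k≤2m) ⟩
      3 * (2 * m) + m  ≡⟨ seven m ⟩
      7 * m ∎
      where
      seven : ∀ m → 3 * (2 * m) + m ≡ 7 * m
      seven = solve-∀

    n³≤343m³ : N³ ≤ 343 * M³
    n³≤343m³ = ℕₚ.≤-trans (ℕₚ.*-mono-≤ (ℕₚ.*-mono-≤ n≤7m n≤7m) n≤7m) (ℕₚ.≤-reflexive (cube m))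
      where
      cube : ∀ m → 7 * m * (7 * m) * (7 * m) ≡ 343 * (m * m * m)
      cube = solve-∀

    step : 324 * s + 12 * M³ ≤ 12 * N³ + 162 * (n * n)
    step = begin
      324 * s + 12 * M³  ≡⟨ cong (_+ 12 * M³) (ℕₚ.*-assoc 27 12 s) ⟩
      27 * (12 * s) + 12 * M³  ≤⟨ ℕₚ.+-monoˡ-≤ (12 * M³) (ℕₚ.*-monoʳ-≤ 27 bound) ⟩
      27 * (12 * (k * k * k) + 12 * (k * k * m) + 3 * (k * (m * m)) + 6 * (n * n)) + 12 * M³
        -- 12(3k + m)³ exceeds 12m³ plus 27 times the cubic part of the bound by exactly 27km².
        ≤⟨ ℕₚ.m≤m+n _ (27 * (k * (m * m))) ⟩
      27 * (12 * (k * k * k) + 12 * (k * k * m) + 3 * (k * (m * m)) + 6 * (n * n)) + 12 * M³ + 27 * (k * (m * m))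
        ≡⟨ expand k m (n * n) ⟩
      12 * ((3 * k + m) * (3 * k + m) * (3 * k + m)) + 162 * (n * n)
        ≡⟨ cong (λ t → 12 * (t * t * t) + 162 * (n * n)) (sym n≡) ⟩
      12 * N³ + 162 * (n * n) ∎
      where
      expand : ∀ k m q →
        27 * (12 * (k * k * k) + 12 * (k * k * m) + 3 * (k * (m * m)) + 6 * q) + 12 * (m * m * m) + 27 * (k * (m * m))
          ≡ 12 * ((3 * k + m) * (3 * k + m) * (3 * k + m)) + 162 * q
      expand = solve-∀

  shadow-or-size : ∀ {n} (H : Graph3 n) → DFree H → 9261 ≤ n →
    6 * shadowSize H ≤ 2 * (n * n) + 3 * n ⊎ 18522 * size H ≤ 685 * (n * n * n)
  shadow-or-size {n} H dfree n-large = byPacking (packing (heavy H) (HeavyPairs.heavy⇒≢ hp) (allFin n))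
    where
    hp = heavyPairs H dfree

    double : ∀ t q → 2 * (t + 3 * q) ≡ 2 * t + 6 * q
    double = solve-∀

    byPacking : Packing (heavy H) (allFin n) →
      6 * shadowSize H ≤ 2 * (n * n) + 3 * n ⊎ 18522 * size H ≤ 685 * (n * n * n)
    byPacking P = [ (λ 2m≤k → inj₁ (small-shadow 2m≤k)) , (λ k≤2m → inj₂ (small-size k≤2m)) ]′ (ℕₚ.≤-total (2 * m) k)
      where
      open Packing P
      open Counting hp P
      k = length triangles
      m = length rest

      small-shadow : 2 * m ≤ k → 6 * shadowSize H ≤ 2 * (n * n) + 3 * n
      small-shadow 2m≤k = shadow-arithmetic {k} {m} {n} {shadowSize H} n≡3k+m (ℕₚ.≤-trans (s≤s z≤n) n-large) 2m≤k
        (ℕₚ.≤-trans (ℕₚ.*-monoʳ-≤ 3 (ℕₚ.*-monoʳ-≤ k (2shadow≤ H))) (adjacentPairs-≤ 2m≤k))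

      small-size : k ≤ 2 * m → 18522 * size H ≤ 685 * (n * n * n)
      small-size k≤2m = size-arithmetic {k} {m} {n} {size H} n≡3k+m n-large k≤2m (begin
        12 * size H  ≡⟨ ℕₚ.*-assoc 2 6 (size H) ⟩
        2 * (6 * size H)  ≤⟨ ℕₚ.*-monoʳ-≤ 2 (ℕₚ.≤-trans (6size≤ H) (ordered≤ H)) ⟩
        2 * (#heavyTriangles H + 3 * (n * n))  ≡⟨ double (#heavyTriangles H) (n * n) ⟩
        2 * #heavyTriangles H + 6 * (n * n)  ≤⟨ ℕₚ.+-monoˡ-≤ (6 * (n * n)) heavyTriangles-≤ ⟩
        12 * (k * k * k) + 12 * (k * k * m) + 3 * (k * (m * m)) + 6 * (n * n) ∎)

  n^2≡n*n : ∀ n → n ^ 2 ≡ n * n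
  n^2≡n*n n = cong (n *_) (ℕₚ.*-identityʳ n)

  n^3≡n*n*n : ∀ n → n ^ 3 ≡ n * n * n
  n^3≡n*n*n n = trans (cong (n *_) (n^2≡n*n n)) (sym (ℕₚ.*-assoc n n n))

  -- With ε = (p + 1)/d, a shadow of at most n²/3 + n/2 leaves εn² ≤ n/2. Since ε ≥ 1/d, this gives
  -- 2n ≤ d, which fails once n reaches the denominator of ε.
  excess-bounds-n : ∀ {d p n s} → 1 ≤ n → 3 * d * s ≡ (d + 3 * suc p) * (n * n) →
    6 * s ≤ 2 * (n * n) + 3 * n → 2 * n ≤ d
  excess-bounds-n {d} {p} {n@(suc _)} {s} _ eq bound = ℕₚ.*-cancelʳ-≤ _ _ n (ℕₚ.*-cancelˡ-≤ 3 (ℕₚ.+-cancelˡ-≤ (2 * d * (n * n)) _ _ (begin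
    2 * d * (n * n) + 3 * (2 * n * n)  ≤⟨ ℕₚ.m≤m+n _ (6 * p * (n * n)) ⟩
    2 * d * (n * n) + 3 * (2 * n * n) + 6 * p * (n * n)  ≡⟨ expand d p n ⟩
    2 * ((d + 3 * suc p) * (n * n))  ≡⟨ cong (2 *_) (sym eq) ⟩
    2 * (3 * d * s)  ≡⟨ regroup d s ⟩
    d * (6 * s)  ≤⟨ ℕₚ.*-monoʳ-≤ d bound ⟩
    d * (2 * (n * n) + 3 * n)  ≡⟨ distribute d n ⟩
    2 * d * (n * n) + 3 * (d * n) ∎)))
    where
    expand : ∀ d p n → 2 * d * (n * n) + 3 * (2 * n * n) + 6 * p * (n * n) ≡ 2 * ((d + 3 * (1 + p)) * (n * n))
    expand = solve-∀
    regroup : ∀ d s → 2 * (3 * d * s) ≡ d * (6 * s)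
    regroup = solve-∀
    distribute : ∀ d n → d * (2 * (n * n) + 3 * n) ≡ 2 * d * (n * n) + 3 * (d * n)
    distribute = solve-∀

-- Transfer to the rational statement

open import Data.Nat using (ℕ; _^_)
open import Data.Integer using (+_)
open import Data.Rational using (ℚ; _/_; _+_; _-_; _*_; _<_; _≤_; 0ℚ)
open import Data.Product using (Σ; _×_)
open import Relation.Binary.PropositionalEquality using (_≡_)
import Data.Nat as ℕ
import Data.Nat.Properties as ℕₚ
open import Data.Nat using (zero; suc)
open import Data.Nat.Tactic.RingSolver using (solve-∀)
open import Data.Integer as ℤ using (-[1+_]; +<+)
import Data.Integer.Properties as ℤₚ
open import Data.Rational using (mkℚ; ↥_; ↧ₙ_; *<*; toℚᵘ)
import Data.Rational.Properties as ℚₚ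
open import Data.Rational.Unnormalised as ℚᵘ using (mkℚᵘ; *≤*)
import Data.Rational.Unnormalised.Properties as ℚᵘₚ
open import Data.Product using (∃; _,_; proj₁; proj₂)
open import Data.Sum using ([_,_]′)
open import Data.Empty using (⊥-elim)
open import Relation.Nullary using (¬_)
open import Relation.Binary.PropositionalEquality using (refl; sym; trans; cong; cong₂; subst; subst₂; module ≡-Reasoning)

open Combinatorics using (shadow-or-size; excess-bounds-n; n^2≡n*n; n^3≡n*n*n)

toℚᵘ-/1 : ∀ s → toℚᵘ (+ s / 1) ℚᵘ.≃ mkℚᵘ (+ s) 0
toℚᵘ-/1 s = ℚₚ.toℚᵘ-fromℚᵘ (mkℚᵘ (+ s) 0)

clear-≤ : ∀ s N → 18522 ℕ.* s ℕ.≤ 685 ℕ.* N → + s / 1 ≤ (+ 1 / 27 - + 1 / 18522) * (+ N / 1)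
clear-≤ s N h = ℚₚ.toℚᵘ-cancel-≤ (ℚᵘₚ.≤-respˡ-≃ (ℚᵘₚ.≃-sym (toℚᵘ-/1 s)) (ℚᵘₚ.≤-respʳ-≃ (ℚᵘₚ.≃-sym rhs) (*≤* core)))
  where
  c = + 1 / 27 - + 1 / 18522
  -- `c` evaluates to 685/18522 in lowest terms; `mkℚᵘ` stores the denominator minus one.
  rhs : toℚᵘ (c * (+ N / 1)) ℚᵘ.≃ mkℚᵘ (+ 685) 18521 ℚᵘ.* mkℚᵘ (+ N) 0
  rhs = ℚᵘₚ.≃-trans (ℚₚ.toℚᵘ-homo-* c (+ N / 1)) (ℚᵘₚ.*-congˡ {mkℚᵘ (+ 685) 18521} (toℚᵘ-/1 N))
  core : + s ℤ.* + 18522 ℤ.≤ (+ 685 ℤ.* + N) ℤ.* + 1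
  core = subst₂ ℤ._≤_ (trans (cong +_ (ℕₚ.*-comm 18522 s)) (ℤₚ.pos-* s 18522))
    (trans (ℤₚ.pos-* 685 N) (sym (ℤₚ.*-identityʳ _))) (ℤ.+≤+ h)

clear-≡ : ∀ s N ε {p} → ↥ ε ≡ + p → + s / 1 ≡ (+ 1 / 3 + ε) * (+ N / 1) →
  3 ℕ.* ↧ₙ ε ℕ.* s ≡ (↧ₙ ε ℕ.+ 3 ℕ.* p) ℕ.* N
clear-≡ s N ε@(mkℚ (+ p) d-1 _) refl eq = ℤₚ.+-injective (begin
  + (3 ℕ.* d ℕ.* s)  ≡⟨ trans (cong +_ (lhs d s)) (ℤₚ.pos-* s (3 ℕ.* d ℕ.* 1)) ⟩
  + s ℤ.* + (3 ℕ.* d ℕ.* 1)  ≡⟨ ℚᵘₚ.drop-*≡* unnormalised ⟩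
  (+ 1 ℤ.* + d ℤ.+ + p ℤ.* + 3) ℤ.* + N ℤ.* + 1  ≡⟨ ℤₚ.*-identityʳ _ ⟩
  (+ 1 ℤ.* + d ℤ.+ + p ℤ.* + 3) ℤ.* + N
    ≡⟨ cong (ℤ._* + N) (cong₂ ℤ._+_ (ℤₚ.*-identityˡ (+ d)) (trans (sym (ℤₚ.pos-* p 3)) (cong +_ (ℕₚ.*-comm p 3)))) ⟩
  + (d ℕ.+ 3 ℕ.* p) ℤ.* + N  ≡⟨ sym (ℤₚ.pos-* (d ℕ.+ 3 ℕ.* p) N) ⟩
  + ((d ℕ.+ 3 ℕ.* p) ℕ.* N) ∎)
  where
  open ≡-Reasoning
  d = suc d-1
  lhs : ∀ d s → 3 ℕ.* d ℕ.* s ≡ s ℕ.* (3 ℕ.* d ℕ.* 1)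
  lhs = solve-∀
  unnormalised : mkℚᵘ (+ s) 0 ℚᵘ.≃ (mkℚᵘ (+ 1) 2 ℚᵘ.+ mkℚᵘ (+ p) d-1) ℚᵘ.* mkℚᵘ (+ N) 0
  unnormalised = ℚᵘₚ.≃-trans (ℚᵘₚ.≃-sym (toℚᵘ-/1 s)) (ℚᵘₚ.≃-trans (ℚᵘₚ.≃-reflexive (cong toℚᵘ eq))
    (ℚᵘₚ.≃-trans (ℚₚ.toℚᵘ-homo-* (+ 1 / 3 + ε) (+ N / 1))
      (ℚᵘₚ.*-cong (ℚₚ.toℚᵘ-homo-+ (+ 1 / 3) ε) (toℚᵘ-/1 N))))

positive-numerator : ∀ ε → 0ℚ < ε → ∃ λ p → ↥ ε ≡ + suc p
positive-numerator (mkℚ (+ suc p) _ _)  _        = p , refl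
positive-numerator (mkℚ (+ zero)  _ _)  (*<* (+<+ ()))
positive-numerator (mkℚ -[1+ _ ]  _ _)  (*<* ())

theorem3p3 : Σ ℚ λ δ₀ → 0ℚ < δ₀ ×
    (∀ (ε : ℚ) → 0ℚ < ε → ε < + 1 / 100000000 →
    Σ ℕ λ N → ∀ (n : ℕ) → N Data.Nat.≤ n → (H : Graph3 n) → DFree H →
    + shadowSize H / 1 ≡ (+ 1 / 3 + ε) * (+ (n ^ 2) / 1) →
    + size H / 1 ≤ (+ 1 / 27 - δ₀) * (+ (n ^ 3) / 1))
-- From 9261 on the quadratic error fits into half of the gap; from `↧ₙ ε` on the small-shadow
-- alternative contradicts the prescribed shadow.
theorem3p3 = + 1 / 18522 , *<* (+<+ (ℕ.s≤s ℕ.z≤n)) , λ ε 0<ε _ → 9261 ℕ.⊔ ↧ₙ ε , λ n N≤n H dfree shadow →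
    [ (λ small-shadow → ⊥-elim (not-small-shadow ε 0<ε
        (ℕₚ.m⊔n≤o⇒m≤o 9261 (↧ₙ ε) N≤n) (ℕₚ.m⊔n≤o⇒n≤o 9261 (↧ₙ ε) N≤n) H shadow small-shadow))
    , (λ small-size → clear-≤ (size H) (n ^ 3)
        (subst (λ t → 18522 ℕ.* size H ℕ.≤ 685 ℕ.* t) (sym (n^3≡n*n*n n)) small-size)) ]′
    (shadow-or-size H dfree (ℕₚ.m⊔n≤o⇒m≤o 9261 (↧ₙ ε) N≤n))
  where
  not-small-shadow : ∀ ε → 0ℚ < ε → ∀ {n} → 9261 ℕ.≤ n → ↧ₙ ε ℕ.≤ n → (H : Graph3 n) →
    + shadowSize H / 1 ≡ (+ 1 / 3 + ε) * (+ (n ^ 2) / 1) →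
    ¬ 6 ℕ.* shadowSize H ℕ.≤ 2 ℕ.* (n ℕ.* n) ℕ.+ 3 ℕ.* n
  not-small-shadow ε 0<ε {n} 9261≤n d≤n H shadow small-shadow = ℕₚ.<⇒≱ n<2n (ℕₚ.≤-trans 2n≤d d≤n)
    where
    0<n : 1 ℕ.≤ n
    0<n = ℕₚ.≤-trans (ℕ.s≤s ℕ.z≤n) 9261≤n
    n<2n : n ℕ.< 2 ℕ.* n
    n<2n = ℕₚ.m<m+n n (subst (1 ℕ.≤_) (sym (ℕₚ.+-identityʳ n)) 0<n)
    p = proj₁ (positive-numerator ε 0<ε)
    2n≤d : 2 ℕ.* n ℕ.≤ ↧ₙ ε
    2n≤d = excess-bounds-n {↧ₙ ε} {p} {n} {shadowSize H} 0<n
      (subst (λ t → 3 ℕ.* ↧ₙ ε ℕ.* shadowSize H ≡ (↧ₙ ε ℕ.+ 3 ℕ.* suc p) ℕ.* t)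
      (n^2≡n*n n) (clear-≡ (shadowSize H) (n ^ 2) ε (proj₂ (positive-numerator ε 0<ε)) shadow)) small-shadow
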